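{- Let $a\geq 7$ be an integer, let $\rho$ be the root greater than $a+1$ of $x^3-ax^2-(a+3)x-1$, and let $\gamma=a^2+a+8+(a^2-a+1)\rho+(2-a)\rho^2\in\mathbb{Z}[\rho]$. Let $\varepsilon$ be a totally positive unit in $\mathbb{Z}[\rho]$. If $\gamma\succeq\varepsilon$, then $\varepsilon\in\{1,\rho^2\}$.
   Context: The polynomial $x^3-ax^2-(a+3)x-1$ is irreducible over $\mathbb{Q}$ with three real roots $\rho,\rho',\rho''$, labelled so that $a+1<\rho$, $-2<\rho'<-1$, $-1<\rho''<0$. The field $K=\mathbb{Q}(\rho)$ is cyclic cubic; for $\alpha\in K$, $\alpha'$ and $\alpha''$ denote the images of $\alpha$ under the $\mathbb{Q}$-isomorphisms given by $\rho\mapsto\rho'$ and $\rho\mapsto\rho''$ respectively. An element $\alpha$ is totally positive if $\alpha,\alpha',\alpha''>0$. For totally positive $\alpha,\beta\in\mathbb{Z}[\rho]$, $\alpha\succ\beta$ means $\alpha>\beta$, $\alpha'>\beta'$ and $\alpha''>\beta''$; $\alpha\succeq\beta$ means $\alpha\succ\beta$ or $\alpha=\beta$. -}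

module Defs where

open import Data.Integer.Base as ℤ using (ℤ; +_; -[1+_])
open import Data.List.Base using (List; []; _∷_; foldr)
open import Data.Nat.Base as ℕ using (ℕ; _⊔_)
import Data.Nat.Properties as ℕ
open import Data.Product.Base using (Σ-syntax; ∃-syntax; _×_; _,_; proj₁; proj₂)
open import Data.Rational.Base as ℚ
  using (ℚ; 0ℚ; 1ℚ; ½; ∣_∣; Positive; positive; 1/_)
open import Data.Rational.Literals using (fromℤ)
import Data.Rational.Properties as ℚ
open import Data.Rational.Solver using (module +-*-Solver)
open import Data.Sum.Base using (_⊎_)
open import Relation.Binary.PropositionalEquality
  using (_≡_; refl; sym; trans; cong; cong₂; subst)

------------------------------------------------------------------------
-- Real numbers: Cauchy sequences of rationals, with setoid equality _≈_.

IsCauchy : (ℕ → ℚ) → Set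
IsCauchy x = ∀ ε → 0ℚ ℚ.< ε →
  ∃[ N ] (∀ m n → N ℕ.≤ m → N ℕ.≤ n → ∣ x m ℚ.- x n ∣ ℚ.< ε)

record ℝ : Set where
  constructor mkℝ
  field
    seq    : ℕ → ℚ
    cauchy : IsCauchy seq

open ℝ public

infix 4 _≈_ _<_

_≈_ : ℝ → ℝ → Set
x ≈ y = ∀ ε → 0ℚ ℚ.< ε →
  ∃[ N ] (∀ n → N ℕ.≤ n → ∣ seq x n ℚ.- seq y n ∣ ℚ.< ε)

-- The uniform gap δ is essential: termwise strict inequality is compatible
-- with equal limits.
_<_ : ℝ → ℝ → Set
x < y = ∃[ δ ] 0ℚ ℚ.< δ ×
  ∃[ N ] (∀ n → N ℕ.≤ n → seq x n ℚ.+ δ ℚ.< seq y n)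

private
  half-pos : ∀ {ε} → 0ℚ ℚ.< ε → 0ℚ ℚ.< ½ ℚ.* ε
  half-pos {ε} 0<ε =
    ℚ.positive⁻¹ _ {{ℚ.pos*pos⇒pos ½ ε {{positive 0<ε}}}}

  half+half : ∀ ε → ½ ℚ.* ε ℚ.+ ½ ℚ.* ε ≡ ε
  half+half ε =
    trans (sym (ℚ.*-distribʳ-+ ε ½ ½)) (ℚ.*-identityˡ ε)

  <-+-halves : ∀ {p q} ε → p ℚ.< ½ ℚ.* ε → q ℚ.< ½ ℚ.* ε → p ℚ.+ q ℚ.< ε
  <-+-halves ε p< q< = subst (_ ℚ.<_) (half+half ε) (ℚ.+-mono-< p< q<)

abstract
  const-cauchy : ∀ q → IsCauchy (λ _ → q)
  const-cauchy q ε 0<ε =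
    0 , λ _ _ _ _ → subst (λ t → ∣ t ∣ ℚ.< ε) (sym (ℚ.+-inverseʳ q)) 0<ε

  +-cauchy : ∀ {x y} → IsCauchy x → IsCauchy y → IsCauchy (λ n → x n ℚ.+ y n)
  +-cauchy {x} {y} cx cy ε 0<ε
    with cx (½ ℚ.* ε) (half-pos 0<ε) | cy (½ ℚ.* ε) (half-pos 0<ε)
  ... | M , hx | N , hy = M ⊔ N , λ m n m≥ n≥ →
    ℚ.≤-<-trans
      (subst (λ t → ∣ t ∣ ℚ.≤ ∣ x m ℚ.- x n ∣ ℚ.+ ∣ y m ℚ.- y n ∣)
         (sym (rearrange (x m) (y m) (x n) (y n)))
         (ℚ.∣p+q∣≤∣p∣+∣q∣ (x m ℚ.- x n) (y m ℚ.- y n)))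
      (<-+-halves ε
        (hx m n (ℕ.m⊔n≤o⇒m≤o M N m≥) (ℕ.m⊔n≤o⇒m≤o M N n≥))
        (hy m n (ℕ.m⊔n≤o⇒n≤o M N m≥) (ℕ.m⊔n≤o⇒n≤o M N n≥)))
    where
    open +-*-Solver
    rearrange : ∀ p q r s →
      (p ℚ.+ q) ℚ.- (r ℚ.+ s) ≡ (p ℚ.- r) ℚ.+ (q ℚ.- s)
    rearrange = solve 4
      (λ p q r s → (p :+ q) :- (r :+ s) := (p :- r) :+ (q :- s)) refl

  cauchy⇒bounded : ∀ {x} → IsCauchy x →
    ∃[ B ] Positive B × ∃[ N ] (∀ n → N ℕ.≤ n → ∣ x n ∣ ℚ.≤ B)
  cauchy⇒bounded {x} cx with cx 1ℚ (ℚ.positive⁻¹ 1ℚ)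
  ... | N , h = 1ℚ ℚ.+ ∣ x N ∣
    , positive (ℚ.+-mono-<-≤ (ℚ.positive⁻¹ 1ℚ) (ℚ.0≤∣p∣ (x N)))
    , N
    , λ n n≥ → ℚ.≤-trans
        (subst (λ t → ∣ t ∣ ℚ.≤ ∣ x n ℚ.- x N ∣ ℚ.+ ∣ x N ∣)
          (cancel (x n) (x N)) (ℚ.∣p+q∣≤∣p∣+∣q∣ (x n ℚ.- x N) (x N)))
        (ℚ.+-monoˡ-≤ ∣ x N ∣ (ℚ.<⇒≤ (h n N n≥ ℕ.≤-refl)))
    where
    open +-*-Solver
    cancel : ∀ p q → (p ℚ.- q) ℚ.+ q ≡ p
    cancel = solve 2 (λ p q → (p :- q) :+ q := p) refl

private
  scaled-cauchy : ∀ {x} → IsCauchy x → ∀ B → Positive B → ∀ ε → 0ℚ ℚ.< ε →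
    ∃[ N ] (∀ m n → N ℕ.≤ m → N ℕ.≤ n → B ℚ.* ∣ x m ℚ.- x n ∣ ℚ.< ε)
  scaled-cauchy {x} cx B B>0 ε 0<ε = N , λ m n m≥ n≥ →
    subst (B ℚ.* ∣ x m ℚ.- x n ∣ ℚ.<_) B*η≡ε
      (ℚ.*-monoʳ-<-pos B {{B>0}} (h m n m≥ n≥))
    where
    instance
      _ = B>0
      _ = ℚ.pos⇒nonZero B
    η : ℚ
    η = 1/ B ℚ.* ε
    0<η : 0ℚ ℚ.< η
    0<η = ℚ.positive⁻¹ η
      {{ℚ.pos*pos⇒pos (1/ B) {{ℚ.1/pos⇒pos B}} ε {{positive 0<ε}}}}
    B*η≡ε : B ℚ.* η ≡ ε
    B*η≡ε = trans (sym (ℚ.*-assoc B (1/ B) ε))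
      (trans (cong (ℚ._* ε) (ℚ.*-inverseʳ B)) (ℚ.*-identityˡ ε))
    N = proj₁ (cx η 0<η)
    h = proj₂ (cx η 0<η)

  ∣pq-rs∣≤ : ∀ p q r s →
    ∣ p ℚ.* q ℚ.- r ℚ.* s ∣ ℚ.≤ ∣ p ∣ ℚ.* ∣ q ℚ.- s ∣ ℚ.+ ∣ s ∣ ℚ.* ∣ p ℚ.- r ∣
  ∣pq-rs∣≤ p q r s = begin
    ∣ p ℚ.* q ℚ.- r ℚ.* s ∣
      ≡⟨ cong ∣_∣ (rearrange p q r s) ⟩
    ∣ p ℚ.* (q ℚ.- s) ℚ.+ s ℚ.* (p ℚ.- r) ∣
      ≤⟨ ℚ.∣p+q∣≤∣p∣+∣q∣ (p ℚ.* (q ℚ.- s)) (s ℚ.* (p ℚ.- r)) ⟩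
    ∣ p ℚ.* (q ℚ.- s) ∣ ℚ.+ ∣ s ℚ.* (p ℚ.- r) ∣
      ≡⟨ cong₂ ℚ._+_ (ℚ.∣p*q∣≡∣p∣*∣q∣ p (q ℚ.- s))
                     (ℚ.∣p*q∣≡∣p∣*∣q∣ s (p ℚ.- r)) ⟩
    ∣ p ∣ ℚ.* ∣ q ℚ.- s ∣ ℚ.+ ∣ s ∣ ℚ.* ∣ p ℚ.- r ∣ ∎
    where
    open ℚ.≤-Reasoning
    open +-*-Solver
    rearrange : ∀ p q r s →
      p ℚ.* q ℚ.- r ℚ.* s ≡ p ℚ.* (q ℚ.- s) ℚ.+ s ℚ.* (p ℚ.- r)
    rearrange = solve 4
      (λ p q r s → p :* q :- r :* s := p :* (q :- s) :+ s :* (p :- r)) refl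

  *∣∣-bound : ∀ {p B ε} r → ∣ p ∣ ℚ.≤ B → B ℚ.* ∣ r ∣ ℚ.< ε → ∣ p ∣ ℚ.* ∣ r ∣ ℚ.< ε
  *∣∣-bound r ∣p∣≤B B∣r∣<ε = ℚ.≤-<-trans
    (ℚ.*-monoʳ-≤-nonNeg ∣ r ∣ {{ℚ.nonNegative (ℚ.0≤∣p∣ r)}} ∣p∣≤B) B∣r∣<ε

abstract
  *-cauchy : ∀ {x y} → IsCauchy x → IsCauchy y → IsCauchy (λ n → x n ℚ.* y n)
  *-cauchy {x} {y} cx cy ε 0<ε =
    let B , B>0 , K , hB = cauchy⇒bounded {x} cx
        C , C>0 , L , hC = cauchy⇒bounded {y} cy
        M , hy = scaled-cauchy {y} cy B B>0 (½ ℚ.* ε) (half-pos 0<ε)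
        N , hx = scaled-cauchy {x} cx C C>0 (½ ℚ.* ε) (half-pos 0<ε)
    in combine hB hC hy hx
    where
    combine : ∀ {B C K L M N} →
      (∀ n → K ℕ.≤ n → ∣ x n ∣ ℚ.≤ B) →
      (∀ n → L ℕ.≤ n → ∣ y n ∣ ℚ.≤ C) →
      (∀ m n → M ℕ.≤ m → M ℕ.≤ n → B ℚ.* ∣ y m ℚ.- y n ∣ ℚ.< ½ ℚ.* ε) →
      (∀ m n → N ℕ.≤ m → N ℕ.≤ n → C ℚ.* ∣ x m ℚ.- x n ∣ ℚ.< ½ ℚ.* ε) →
      ∃[ P ] (∀ m n → P ℕ.≤ m → P ℕ.≤ n →
        ∣ x m ℚ.* y m ℚ.- x n ℚ.* y n ∣ ℚ.< ε)
    combine {B} {C} {K} {L} {M} {N} hB hC hy hx = (K ⊔ L) ⊔ (M ⊔ N) , bound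
      where
      K≤ : ∀ {n} → (K ⊔ L) ⊔ (M ⊔ N) ℕ.≤ n → K ℕ.≤ n
      K≤ n≥ = ℕ.m⊔n≤o⇒m≤o K L (ℕ.m⊔n≤o⇒m≤o (K ⊔ L) (M ⊔ N) n≥)
      L≤ : ∀ {n} → (K ⊔ L) ⊔ (M ⊔ N) ℕ.≤ n → L ℕ.≤ n
      L≤ n≥ = ℕ.m⊔n≤o⇒n≤o K L (ℕ.m⊔n≤o⇒m≤o (K ⊔ L) (M ⊔ N) n≥)
      M≤ : ∀ {n} → (K ⊔ L) ⊔ (M ⊔ N) ℕ.≤ n → M ℕ.≤ n
      M≤ n≥ = ℕ.m⊔n≤o⇒m≤o M N (ℕ.m⊔n≤o⇒n≤o (K ⊔ L) (M ⊔ N) n≥)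
      N≤ : ∀ {n} → (K ⊔ L) ⊔ (M ⊔ N) ℕ.≤ n → N ℕ.≤ n
      N≤ n≥ = ℕ.m⊔n≤o⇒n≤o M N (ℕ.m⊔n≤o⇒n≤o (K ⊔ L) (M ⊔ N) n≥)
      bound : ∀ m n → (K ⊔ L) ⊔ (M ⊔ N) ℕ.≤ m → (K ⊔ L) ⊔ (M ⊔ N) ℕ.≤ n →
        ∣ x m ℚ.* y m ℚ.- x n ℚ.* y n ∣ ℚ.< ε
      bound m n m≥ n≥ = ℚ.≤-<-trans (∣pq-rs∣≤ (x m) (y m) (x n) (y n))
        (<-+-halves ε
          (*∣∣-bound {x m} (y m ℚ.- y n) (hB m (K≤ m≥)) (hy m n (M≤ m≥) (M≤ n≥)))
          (*∣∣-bound {y n} (x m ℚ.- x n) (hC n (L≤ n≥)) (hx m n (N≤ m≥) (N≤ n≥))))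

infixl 6 _+_
infixl 7 _*_

_+_ : ℝ → ℝ → ℝ
mkℝ x cx + mkℝ y cy = mkℝ (λ n → x n ℚ.+ y n) (+-cauchy {x} {y} cx cy)

_*_ : ℝ → ℝ → ℝ
mkℝ x cx * mkℝ y cy = mkℝ (λ n → x n ℚ.* y n) (*-cauchy {x} {y} cx cy)

ι : ℤ → ℝ
ι i = mkℝ (λ _ → fromℤ i) (const-cauchy (fromℤ i))

------------------------------------------------------------------------
-- Integer polynomials, as coefficient lists with the constant term first.

ℤ[X] : Set
ℤ[X] = List ℤ

eval : ℤ[X] → ℝ → ℝ
eval p x = foldr (λ c r → ι c + x * r) (ι (+ 0)) p

cubic : ℤ → ℤ[X]
cubic a = -[1+ 0 ] ∷ ℤ.- (a ℤ.+ + 3) ∷ ℤ.- a ∷ + 1 ∷ []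

record Roots (a : ℤ) : Set where
  field
    ρ ρ′ ρ″ : ℝ
    ρ-root  : eval (cubic a) ρ  ≈ ι (+ 0)
    ρ′-root : eval (cubic a) ρ′ ≈ ι (+ 0)
    ρ″-root : eval (cubic a) ρ″ ≈ ι (+ 0)
    a+1<ρ   : ι (a ℤ.+ + 1) < ρ
    -2<ρ′   : ι -[1+ 1 ] < ρ′
    ρ′<-1   : ρ′ < ι -[1+ 0 ]
    -1<ρ″   : ι -[1+ 0 ] < ρ″
    ρ″<0    : ρ″ < ι (+ 0)

------------------------------------------------------------------------
-- The order ℤ[ρ] ⊆ ℝ. An element α = p(ρ) is presented by any polynomial
-- p ∈ ℤ[X]; two presentations are identified (_≃_) when they have the same
-- value at ρ. The conjugates of α are p(ρ′) and p(ρ″); they do not depend on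
-- the presentation because the cubic is irreducible over ℚ.

module ℤ[ρ] {a : ℤ} (R : Roots a) where

  open Roots R public

  infix 4 _≃_ _≻_ _≽_

  value conj′ conj″ : ℤ[X] → ℝ
  value p = eval p ρ
  conj′ p = eval p ρ′
  conj″ p = eval p ρ″

  _≃_ : ℤ[X] → ℤ[X] → Set
  p ≃ q = value p ≈ value q

  IsUnit : ℤ[X] → Set
  IsUnit p = Σ[ q ∈ ℤ[X] ] value p * value q ≈ ι (+ 1)

  TotallyPositive : ℤ[X] → Set
  TotallyPositive p = ι (+ 0) < value p × ι (+ 0) < conj′ p × ι (+ 0) < conj″ p

  _≻_ : ℤ[X] → ℤ[X] → Set
  p ≻ q = value q < value p × conj′ q < conj′ p × conj″ q < conj″ p

  _≽_ : ℤ[X] → ℤ[X] → Set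
  p ≽ q = p ≻ q ⊎ p ≃ q

  one : ℤ[X]
  one = + 1 ∷ []

  ρ² : ℤ[X]
  ρ² = + 0 ∷ + 0 ∷ + 1 ∷ []

  γ : ℤ[X]
  γ = (a ℤ.* a ℤ.+ a ℤ.+ + 8)
    ∷ (a ℤ.* a ℤ.- a ℤ.+ + 1)
    ∷ (+ 2 ℤ.- a)
    ∷ []

{-# OPTIONS --safe #-}

-- ℤ[ρ] = ℤ ⊕ ℤρ ⊕ ℤρ′ and for α = x + bρ + cρ′ the conjugates satisfy
--   α² + α′² + α″² − αα′ − α′α″ − α″α = (a² + 3a + 9)(b² − bc + c²).
-- Hence a unit of norm 1 for which the left side (its "energy") is below
-- 3(a² + 3a + 9) has b² − bc + c² ≤ 1, and solving the remaining cubic norm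
-- equations leaves 1, ρ, ρ′, ρ″ and their inverses.
-- A totally positive unit ε ≼ γ lies in the box ε < (a+2)², ε′ < 11,
-- ε″ < (a+1)².  According to the sizes of its conjugates, one of
--   ε, ρ^±1 ε, ρ^±2 ε, ε/ρ′, ρ″ε, ρ″ε/ρ′
-- has energy below 3(a² + 3a + 9), so it is on that list; the signs and the
-- bounds on its conjugates then leave only ε = 1 and ε = ρ².
module Submission where

open import Algebra.Bundles using (CommutativeRing; RawRing)
import Algebra.Solver.Ring
open import Algebra.Solver.Ring.AlmostCommutativeRing
  using (fromCommutativeRing; _-Raw-AlmostCommutative⟶_)
open import Data.Bool.Base using (Bool; true; false; _xor_; _∧_)
open import Data.Empty using (⊥-elim)
open import Data.Fin using (#_)
open import Data.Fin.Base using (Fin)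
open import Data.Integer.Base as ℤ using (ℤ; +_; -[1+_])
open import Data.Integer.DivMod using (_/ℕ_; _%ℕ_; a≡a%ℕn+[a/ℕn]*n; n%ℕd<d)
import Data.Integer.Properties as ℤ
import Data.Integer.Solver
open import Data.List.Base using (List; []; _∷_; foldr)
open import Data.Maybe.Base using (Maybe; just; nothing)
open import Data.Nat.Base as ℕ using (ℕ; zero; suc; z≤n; s≤s)
import Data.Nat.Properties as ℕ
open import Data.Product.Base using (∃-syntax; _×_; _,_; proj₁; proj₂)
import Data.Rational.Properties as ℚ
import Data.Rational.Solver
import Data.Rational.Unnormalised.Base as ℚᵘ
import Data.Rational.Unnormalised.Properties as ℚᵘ
open import Data.Sum.Base using (_⊎_; inj₁; inj₂; [_,_]′)
open import Data.Vec.Base using (Vec; []; _∷_; lookup)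
open import Level using (0ℓ)
open import Relation.Binary.Definitions using (tri<; tri≈; tri>)
open import Relation.Binary.PropositionalEquality as ≡ using (_≡_)
open import Relation.Nullary using (¬_; contradiction; yes; no)
import Defs

-- The order ℤ[ρ] in coordinates

module IntegerCoordinates where

  open import Data.Integer.Base hiding (suc)
  open import Data.Integer.Properties
  open Data.Integer.Solver using (module +-*-Solver)
  open ≡ using (refl; sym; trans; cong; cong₂; subst)

  record Triple (A : Set) : Set where
    constructor ⟨_,_,_⟩
    field
      c₁ cρ cρ′ : A

  open Triple

  -- ⟨ x , b , c ⟩ stands for x + bρ + cρ′, and σ for ρ ↦ ρ′ ↦ ρ″.  The formulas are
  -- stated over a raw ring so that they can be instantiated with solver syntax as well.
  module Cubic (R : RawRing 0ℓ 0ℓ) (a : RawRing.Carrier R) where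
    open RawRing R renaming (_+_ to _⊕_; _*_ to _⊗_; -_ to ⊝_)

    3# 9# : Carrier
    3# = 1# ⊕ 1# ⊕ 1#
    9# = 3# ⊗ 3#

    infixl 6 _∔_
    infixl 7 _·_

    _∔_ : Triple Carrier → Triple Carrier → Triple Carrier
    ⟨ x , b , c ⟩ ∔ ⟨ y , d , e ⟩ = ⟨ x ⊕ y , b ⊕ d , c ⊕ e ⟩

    _·_ : Triple Carrier → Triple Carrier → Triple Carrier
    ⟨ x , b , c ⟩ · ⟨ y , d , e ⟩ =
      ⟨ x ⊗ y ⊕ b ⊗ d ⊗ (a ⊕ 1# ⊕ 1#) ⊕ ⊝ (b ⊗ e ⊕ c ⊗ d) ⊕ (1# ⊕ 1#) ⊗ c ⊗ e
      , x ⊗ d ⊕ b ⊗ y ⊕ a ⊗ b ⊗ d ⊕ ⊝ (b ⊗ e ⊕ c ⊗ d) ⊕ c ⊗ e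
      , x ⊗ e ⊕ c ⊗ y ⊕ ⊝ (b ⊗ d) ⊕ (a ⊕ 1#) ⊗ c ⊗ e
      ⟩

    σ : Triple Carrier → Triple Carrier
    σ ⟨ x , b , c ⟩ = ⟨ x ⊕ c ⊗ a , ⊝ c , b ⊕ ⊝ c ⟩

    constant : Carrier → Triple Carrier
    constant x = ⟨ x , 0# , 0# ⟩

    form : Carrier → Carrier → Carrier
    form b c = b ⊗ b ⊕ ⊝ (b ⊗ c) ⊕ c ⊗ c

    h : Triple Carrier → Carrier
    h ⟨ _ , b , c ⟩ = form b c

    conductor : Carrier
    conductor = a ⊗ a ⊕ 3# ⊗ a ⊕ 9#

    norm : Triple Carrier → Carrier
    norm ⟨ x , b , c ⟩ =
      x ⊗ x ⊗ x ⊕ a ⊗ (b ⊕ c) ⊗ (x ⊗ x)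
      ⊕ (a ⊗ a ⊗ b ⊗ c ⊕ ⊝ ((a ⊕ 3#) ⊗ form b c)) ⊗ x
      ⊕ b ⊗ b ⊗ b ⊕ ⊝ ((a ⊗ a ⊕ 3# ⊗ a ⊕ 3# ⊕ 3#) ⊗ b ⊗ b ⊗ c)
      ⊕ 3# ⊗ b ⊗ c ⊗ c ⊕ c ⊗ c ⊗ c

  ⟨⟩-cong : ∀ {A : Set} {x y b d c e : A} → x ≡ y → b ≡ d → c ≡ e → ⟨ x , b , c ⟩ ≡ ⟨ y , d , e ⟩
  ⟨⟩-cong refl refl refl = refl

  polyRing : ℕ → RawRing 0ℓ 0ℓ
  polyRing n = record
    { Carrier = Polynomial n ; _≈_ = _≡_ ; _+_ = _:+_ ; _*_ = _:*_ ; -_ = :-_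
    ; 0# = con (+ 0) ; 1# = con (+ 1) }
    where open +-*-Solver

  module Order (a : ℤ) where
    open Cubic +-*-rawRing a public
    private
      module P {n} = Cubic (polyRing n)
      open +-*-Solver

    private
      N₀ : ∀ {n} (a x b c : Polynomial n) → Triple (Polynomial n)
      N₀ {n} a x b c = let α = ⟨ x , b , c ⟩ in α ·′ (σ′ α ·′ σ′ (σ′ α))
        where open P a renaming (_·_ to _·′_; σ to σ′)

    ·-norm : ∀ α → α · (σ α · σ (σ α)) ≡ constant (norm α)
    ·-norm ⟨ x , b , c ⟩ = ⟨⟩-cong
      (solve 4 (λ a x b c → c₁ (N₀ a x b c) := P.norm a ⟨ x , b , c ⟩) refl a x b c)
      (solve 4 (λ a x b c → cρ (N₀ a x b c) := con (+ 0)) refl a x b c)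
      (solve 4 (λ a x b c → cρ′ (N₀ a x b c) := con (+ 0)) refl a x b c)

    private
      K₀ K₁ : ∀ {n} (a x b c : Polynomial n) → Triple (Polynomial n)
      K₀ a x b c = let α = ⟨ x , b , c ⟩ in α ·′ α ∔′ σ′ α ·′ σ′ α ∔′ σ′ (σ′ α) ·′ σ′ (σ′ α)
        where open P a renaming (_·_ to _·′_; σ to σ′; _∔_ to _∔′_)
      K₁ a x b c = let α = ⟨ x , b , c ⟩ in
        constant′ (conductor′ :* h′ α) ∔′ (α ·′ σ′ α ∔′ σ′ α ·′ σ′ (σ′ α) ∔′ σ′ (σ′ α) ·′ α)
        where
        open P a renaming
          (_·_ to _·′_; σ to σ′; _∔_ to _∔′_; constant to constant′; conductor to conductor′; h to
              h′)

    ·-h : ∀ α → α · α ∔ σ α · σ α ∔ σ (σ α) · σ (σ α) ≡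
      constant (conductor * h α) ∔ (α · σ α ∔ σ α · σ (σ α) ∔ σ (σ α) · α)
    ·-h ⟨ x , b , c ⟩ = ⟨⟩-cong
      (solve 4 (λ a x b c → c₁ (K₀ a x b c) := c₁ (K₁ a x b c)) refl a x b c)
      (solve 4 (λ a x b c → cρ (K₀ a x b c) := cρ (K₁ a x b c)) refl a x b c)
      (solve 4 (λ a x b c → cρ′ (K₀ a x b c) := cρ′ (K₁ a x b c)) refl a x b c)

  bit : Bool → ℤ
  bit false = + 0
  bit true  = + 1

  infixr 4 _∙_
  record Parity (i : ℤ) (β : Bool) : Set where
    constructor _∙_
    field
      half : ℤ
      i≡   : i ≡ bit β + + 2 * half

  parity : ∀ i → ∃[ β ] Parity i β
  parity i with i %ℕ 2 in eq | n%ℕd<d i 2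
  ... | 0 | _ = false , i /ℕ 2 ∙ trans (a≡a%ℕn+[a/ℕn]*n i 2)
      (cong₂ _+_ (cong +_ eq) (*-comm (i /ℕ 2) (+ 2)))
  ... | 1 | _ = true  , i /ℕ 2 ∙ trans (a≡a%ℕn+[a/ℕn]*n i 2)
      (cong₂ _+_ (cong +_ eq) (*-comm (i /ℕ 2) (+ 2)))
  ... | suc (suc _) | s≤s (s≤s ())

  private
    module _ where
      open +-*-Solver

      +-parity : ∀ {i j} β β′ → Parity i β → Parity j β′ → Parity (i + j) (β xor β′)
      +-parity false β′ (k ∙ refl) (l ∙ refl) =
        k + l ∙ solve 3 (λ k l b → con (+ 0) :+ con (+ 2) :* k :+ (b :+ con (+ 2) :* l) :=
            b :+ con (+ 2) :* (k :+ l)) refl k l (bit β′)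
      +-parity true false (k ∙ refl) (l ∙ refl) =
        k + l ∙ solve 2 (λ k l → con (+ 1) :+ con (+ 2) :* k :+ (con (+ 0) :+ con (+ 2) :* l) :=
            con (+ 1) :+ con (+ 2) :* (k :+ l)) refl k l
      +-parity true true (k ∙ refl) (l ∙ refl) =
        k + l + + 1 ∙ solve 2 (λ k l → con (+ 1) :+ con (+ 2) :* k :+ (con (+ 1) :+ con (+ 2) :* l)
            := con (+ 0) :+ con (+ 2) :* (k :+ l :+ con (+ 1))) refl k l

      *-parity : ∀ {i j} β β′ → Parity i β → Parity j β′ → Parity (i * j) (β ∧ β′)
      *-parity false β′ (k ∙ refl) (l ∙ refl) =
        k * (bit β′ + + 2 * l) ∙ solve 3 (λ k l b →
            (con (+ 0) :+ con (+ 2) :* k) :* (b :+ con (+ 2) :* l) :=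
            con (+ 0) :+ con (+ 2) :* (k :* (b :+ con (+ 2) :* l))) refl k l (bit β′)
      *-parity true β′ (k ∙ refl) (l ∙ refl) =
        l + k * (bit β′ + + 2 * l) ∙ solve 3 (λ k l b →
            (con (+ 1) :+ con (+ 2) :* k) :* (b :+ con (+ 2) :* l) :=
            b :+ con (+ 2) :* (l :+ k :* (b :+ con (+ 2) :* l))) refl k l (bit β′)

      neg-parity : ∀ {i} β → Parity i β → Parity (- i) β
      neg-parity β (k ∙ refl) =
        - (bit β + k) ∙ solve 2 (λ b k → :- (b :+ con (+ 2) :* k) := b :+ con (+ 2) :* :- (b :+ k))
            refl (bit β) k

  open Parity

  ¬odd-0 : ¬ Parity (+ 0) true
  ¬odd-0 (k ∙ eq) = even≢1 ∣ k ∣ (trans (sym (abs-* (+ 2) k)) (cong ∣_∣ 2k≡-1))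
    where
    2k≡-1 : + 2 * k ≡ - (+ 1)
    2k≡-1 = trans (sym (trans (sym (+-assoc (- (+ 1)) (+ 1) (+ 2 * k))) (+-identityˡ (+ 2 * k))))
      (cong (λ t → - (+ 1) + t) (sym eq))
    even≢1 : ∀ n → ¬ (2 ℕ.* n ≡ 1)
    even≢1 (suc n) eq with () ← trans (sym (ℕ.+-suc n (n ℕ.+ 0))) (ℕ.suc-injective eq)

  module _ (R S : RawRing 0ℓ 0ℓ) where
    private
      module R = RawRing R
      module S = RawRing S

    norm-preserves : (_~_ : R.Carrier → S.Carrier → Set) →
      (∀ {i j β β′} → i ~ β → j ~ β′ → (i R.+ j) ~ (β S.+ β′)) →
      (∀ {i j β β′} → i ~ β → j ~ β′ → (i R.* j) ~ (β S.* β′)) →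
      (∀ {i β} → i ~ β → (R.- i) ~ (S.- β)) →
      R.1# ~ S.1# →
      ∀ {a x b c a′ x′ b′ c′} → a ~ a′ → x ~ x′ → b ~ b′ → c ~ c′ →
      Cubic.norm R a ⟨ x , b , c ⟩ ~ Cubic.norm S a′ ⟨ x′ , b′ , c′ ⟩
    norm-preserves _~_ add mul neg one a x b c =
      ((x ⊗ x) ⊗ x) ⊕ ((a ⊗ (b ⊕ c)) ⊗ (x ⊗ x))
      ⊕ ((((a ⊗ a) ⊗ b) ⊗ c) ⊕ neg ((a ⊕ 3~) ⊗ ((b ⊗ b) ⊕ neg (b ⊗ c) ⊕ (c ⊗ c)))) ⊗ x
      ⊕ ((b ⊗ b) ⊗ b) ⊕ neg ((((((a ⊗ a) ⊕ (3~ ⊗ a)) ⊕ 3~ ⊕ 3~) ⊗ b) ⊗ b) ⊗ c)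
      ⊕ (((3~ ⊗ b) ⊗ c) ⊗ c) ⊕ ((c ⊗ c) ⊗ c)
      where
      infixl 6 _⊕_
      infixl 7 _⊗_
      _⊕_ : ∀ {i j β β′} → i ~ β → j ~ β′ → (i R.+ j) ~ (β S.+ β′)
      _⊕_ = add
      _⊗_ : ∀ {i j β β′} → i ~ β → j ~ β′ → (i R.* j) ~ (β S.* β′)
      _⊗_ = mul
      3~ = one ⊕ one ⊕ one

  𝔽₂ : RawRing 0ℓ 0ℓ
  𝔽₂ = record { Carrier = Bool ; _≈_ = _≡_ ; _+_ = _xor_ ; _*_ = _∧_ ; -_ = λ β → β ; 0# =
      false ; 1# = true }

  norm-parity : ∀ {a x b c} βa βx βb βc → Parity a βa → Parity x βx → Parity b βb → Parity c βc →
    Parity (Order.norm a ⟨ x , b , c ⟩) (Cubic.norm 𝔽₂ βa ⟨ βx , βb , βc ⟩)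
  norm-parity βa βx βb βc = norm-preserves +-*-rawRing 𝔽₂ Parity
    (λ {_} {_} {β} {β′} → +-parity β β′) (λ {_} {_} {β} {β′} → *-parity β β′)
        (λ {_} {β} → neg-parity β) (+ 0 ∙ refl)

  AllEven : ℤ → ℤ → ℤ → Set
  AllEven x b c = Parity x false × Parity b false × Parity c false

  -- 2 is inert: x³ − ax² − (a+3)x − 1 has no root in 𝔽₂.
  even-norm⇒all-even : ∀ a x b c → Order.norm a ⟨ x , b , c ⟩ ≡ + 0 → AllEven x b c
  even-norm⇒all-even a x b c eq with parity a | parity x | parity b | parity c
  ... | βa , pa | βx , px | βb , pb | βc , pc =
    check βa βx βb βc px pb pc (subst (λ t → Parity t _) eq (norm-parity βa βx βb βc pa px pb pc))
    where
    check : ∀ βa βx βb βc → Parity x βx → Parity b βb → Parity c βc →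
      Parity (+ 0) (Cubic.norm 𝔽₂ βa ⟨ βx , βb , βc ⟩) → AllEven x b c
    check _     false false false px pb pc _ = px , pb , pc
    check false false false true  _ _ _ p = contradiction p ¬odd-0
    check false false true  false _ _ _ p = contradiction p ¬odd-0
    check false false true  true  _ _ _ p = contradiction p ¬odd-0
    check false true  false false _ _ _ p = contradiction p ¬odd-0
    check false true  false true  _ _ _ p = contradiction p ¬odd-0
    check false true  true  false _ _ _ p = contradiction p ¬odd-0
    check false true  true  true  _ _ _ p = contradiction p ¬odd-0
    check true  false false true  _ _ _ p = contradiction p ¬odd-0
    check true  false true  false _ _ _ p = contradiction p ¬odd-0
    check true  false true  true  _ _ _ p = contradiction p ¬odd-0
    check true  true  false false _ _ _ p = contradiction p ¬odd-0
    check true  true  false true  _ _ _ p = contradiction p ¬odd-0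
    check true  true  true  false _ _ _ p = contradiction p ¬odd-0
    check true  true  true  true  _ _ _ p = contradiction p ¬odd-0

  size : Triple ℤ → ℕ
  size ⟨ x , b , c ⟩ = ∣ x ∣ ℕ.+ ∣ b ∣ ℕ.+ ∣ c ∣

  module Anisotropic (a : ℤ) where
    open Order a
    open +-*-Solver

    private
      halve : ∀ x b c → norm ⟨ + 0 + + 2 * x , + 0 + + 2 * b , + 0 + + 2 * c ⟩ ≡ + 8 * norm ⟨ x ,
          b , c ⟩
      halve x b c = solve 4 (λ a x b c →
          Cubic.norm (polyRing 4) a ⟨ dbl x , dbl b , dbl c ⟩ :=
              con (+ 8) :* Cubic.norm (polyRing 4) a ⟨ x , b , c ⟩) refl a x b c
        where
        dbl : Polynomial 4 → Polynomial 4
        dbl x = con (+ 0) :+ con (+ 2) :* x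

      ∣2k∣ : ∀ k → ∣ + 0 + + 2 * k ∣ ≡ 2 ℕ.* ∣ k ∣
      ∣2k∣ k = trans (cong ∣_∣ (+-identityˡ (+ 2 * k))) (abs-* (+ 2) k)

      half≤ : ∀ m {n} → m ℕ.+ m ℕ.≤ suc n → m ℕ.≤ n
      half≤ zero    _       = z≤n
      half≤ (suc m) (s≤s p) = ℕ.≤-trans (ℕ.m≤n+m (suc m) m) p

      descent : ∀ n x b c → size ⟨ x , b , c ⟩ ℕ.≤ n → norm ⟨ x , b , c ⟩ ≡ + 0 → ⟨ x , b ,
          c ⟩ ≡ constant (+ 0)
      descent zero x b c le _ = ⟨⟩-cong
        (∣i∣≡0⇒i≡0 (ℕ.m+n≡0⇒m≡0 ∣ x ∣ (ℕ.m+n≡0⇒m≡0 (∣ x ∣ ℕ.+ ∣ b ∣) eq)))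
        (∣i∣≡0⇒i≡0 (ℕ.m+n≡0⇒n≡0 ∣ x ∣ (ℕ.m+n≡0⇒m≡0 (∣ x ∣ ℕ.+ ∣ b ∣) eq)))
        (∣i∣≡0⇒i≡0 (ℕ.m+n≡0⇒n≡0 (∣ x ∣ ℕ.+ ∣ b ∣) eq))
        where eq = ℕ.n≤0⇒n≡0 le
      descent (suc n) x b c le N≡0 = halved (even-norm⇒all-even a x b c N≡0)
        where
        double : ∀ p q r → 2 ℕ.* p ℕ.+ 2 ℕ.* q ℕ.+ 2 ℕ.* r ≡ (p ℕ.+ q ℕ.+ r) ℕ.+ (p ℕ.+ q ℕ.+ r)
        double p q r = trans (cong (ℕ._+ 2 ℕ.* r) (sym (ℕ.*-distribˡ-+ 2 p q)))
          (trans (sym (ℕ.*-distribˡ-+ 2 (p ℕ.+ q) r)) (cong (p ℕ.+ q ℕ.+ r ℕ.+_) (ℕ.+-identityʳ _)))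
        ∣i∣≡ : ∀ {i} (p : Parity i false) → ∣ i ∣ ≡ 2 ℕ.* ∣ half p ∣
        ∣i∣≡ p = trans (cong ∣_∣ (i≡ p)) (∣2k∣ (half p))
        i≡0 : ∀ {i} (p : Parity i false) → half p ≡ + 0 → i ≡ + 0
        i≡0 p eq = trans (i≡ p) (cong (λ k → + 0 + + 2 * k) eq)
        halved : AllEven x b c → ⟨ x , b , c ⟩ ≡ constant (+ 0)
        halved (px , pb , pc) = ⟨⟩-cong (i≡0 px (cong c₁ ih)) (i≡0 pb (cong cρ ih))
            (i≡0 pc (cong cρ′ ih))
          where
          le′ : size ⟨ half px , half pb , half pc ⟩ ℕ.≤ n
          le′ = half≤ _ (subst (ℕ._≤ suc n)
            (trans (cong₂ ℕ._+_ (cong₂ ℕ._+_ (∣i∣≡ px) (∣i∣≡ pb)) (∣i∣≡ pc))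
              (double (∣ half px ∣) (∣ half pb ∣) (∣ half pc ∣))) le)
          ih : ⟨ half px , half pb , half pc ⟩ ≡ constant (+ 0)
          ih = descent n _ _ _ le′ (*-cancelˡ-≡ (+ 8) (norm ⟨ half px , half pb , half pc ⟩) (+ 0)
            (trans (sym (halve (half px) (half pb) (half pc)))
              (trans (cong norm (sym (⟨⟩-cong (i≡ px) (i≡ pb) (i≡ pc)))) N≡0)))

    norm≡0⇒≡0 : ∀ α → norm α ≡ + 0 → α ≡ constant (+ 0)
    norm≡0⇒≡0 ⟨ x , b , c ⟩ = descent _ x b c ℕ.≤-refl

  square≡+∣∣² : ∀ i → i * i ≡ + (∣ i ∣ ℕ.* ∣ i ∣)
  square≡+∣∣² (+ n)    = sym (pos-* n n)
  square≡+∣∣² -[1+ n ] = refl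

  ∣i∣≤1⇒ : ∀ i → ∣ i ∣ ℕ.≤ 1 → i ≡ + 0 ⊎ i ≡ + 1 ⊎ i ≡ -[1+ 0 ]
  ∣i∣≤1⇒ (+ 0)           _ = inj₁ refl
  ∣i∣≤1⇒ (+ 1)           _ = inj₂ (inj₁ refl)
  ∣i∣≤1⇒ (+ suc (suc n)) (s≤s ())
  ∣i∣≤1⇒ -[1+ 0 ]        _ = inj₂ (inj₂ refl)
  ∣i∣≤1⇒ -[1+ suc n ]    (s≤s ())

  ij≡2⇒∣j-i∣≤4 : ∀ i j → i * j ≡ + 2 → ∣ j - i ∣ ℕ.≤ 4
  ij≡2⇒∣j-i∣≤4 i j eq = ℕ.≤-trans (∣i-j∣≤∣i∣+∣j∣ j i)
    (ℕ.+-mono-≤ (factor≤2 ∣ j ∣ ∣ i ∣ (trans (ℕ.*-comm ∣ j ∣ ∣ i ∣) eq′))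
        (factor≤2 ∣ i ∣ ∣ j ∣ eq′))
    where
    eq′ : ∣ i ∣ ℕ.* ∣ j ∣ ≡ 2
    eq′ = trans (sym (abs-* i j)) (cong ∣_∣ eq)
    factor≤2 : ∀ m n → m ℕ.* n ≡ 2 → m ℕ.≤ 2
    factor≤2 m zero    mn≡2 with () ← trans (sym (ℕ.*-zeroʳ m)) mn≡2
    factor≤2 m (suc n) mn≡2 = ℕ.≤-trans (ℕ.m≤m*n m (suc n)) (ℕ.≤-reflexive mn≡2)

  cube≡1⇒≡1 : ∀ x → x * x * x ≡ + 1 → x ≡ + 1
  cube≡1⇒≡1 x eq with ℕ.m*n≡1⇒n≡1 (∣ x ∣ ℕ.* ∣ x ∣) ∣ x ∣
      (trans (cong (ℕ._* ∣ x ∣) (sym (abs-* x x))) (trans (sym (abs-* (x * x) x)) (cong ∣_∣ eq)))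
  cube≡1⇒≡1 (+ 1) eq | _ = refl
  cube≡1⇒≡1 -[1+ 0 ] () | _

  module Small (a : ℤ) (7≤a : + 7 ≤ a) where
    open Order a
    open +-*-Solver

    private
      form<3⇒∣c∣≤1 : ∀ b c → form b c < + 3 → ∣ c ∣ ℕ.≤ 1
      form<3⇒∣c∣≤1 b c lt with ∣ c ∣ ℕ.≤? 1
      ... | yes le = le
      ... | no ≰1 = contradiction lt′ (ℕ.≤⇒≯ 12≤)
        where
        4form : + 4 * form b c ≡ + (∣ + 2 * b - c ∣ ℕ.* ∣ + 2 * b - c ∣ ℕ.+ 3 ℕ.* (∣ c ∣ ℕ.* ∣ c ∣))
        4form = trans (solve 2 (λ b c → con (+ 4) :* Cubic.form (polyRing 2) (con (+ 0)) b c :=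
                  (con (+ 2) :* b :- c) :* (con (+ 2) :* b :- c) :+ con (+ 3) :* (c :* c)) refl b c)
          (trans (cong₂ _+_ (square≡+∣∣² (+ 2 * b - c))
              (trans (cong (+ 3 *_) (square≡+∣∣² c)) (sym (pos-* 3 (∣ c ∣ ℕ.* ∣ c ∣))))) refl)
        lt′ : ∣ + 2 * b - c ∣ ℕ.* ∣ + 2 * b - c ∣ ℕ.+ 3 ℕ.* (∣ c ∣ ℕ.* ∣ c ∣) ℕ.< 12
        lt′ = drop‿+<+ (subst (_< + 12) 4form (*-monoˡ-<-pos (+ 4) lt))
        12≤ : 12 ℕ.≤ ∣ + 2 * b - c ∣ ℕ.* ∣ + 2 * b - c ∣ ℕ.+ 3 ℕ.* (∣ c ∣ ℕ.* ∣ c ∣)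
        12≤ = ℕ.≤-trans (ℕ.*-monoʳ-≤ 3 (ℕ.*-mono-≤ (ℕ.≰⇒> ≰1) (ℕ.≰⇒> ≰1)))
            (ℕ.m≤n+m (3 ℕ.* (∣ c ∣ ℕ.* ∣ c ∣)) (∣ + 2 * b - c ∣ ℕ.* ∣ + 2 * b - c ∣))

      form-sym : ∀ b c → form b c ≡ form c b
      form-sym = solve 2 (λ b c → Cubic.form (polyRing 2) (con (+ 0)) b c :=
          Cubic.form (polyRing 2) (con (+ 0)) c b) refl

    data Neighbour : Triple ℤ → Set where
      isOne  : Neighbour ⟨ + 1 , + 0 , + 0 ⟩
      isρ    : Neighbour ⟨ + 0 , + 1 , + 0 ⟩
      isρ′   : Neighbour ⟨ + 0 , + 0 , + 1 ⟩
      isρ″   : Neighbour ⟨ a , -[1+ 0 ] , -[1+ 0 ] ⟩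
      is1/ρ  : Neighbour ⟨ -[1+ 0 ] , + 0 , -[1+ 0 ] ⟩
      is1/ρ′ : Neighbour ⟨ -[1+ 0 ] - a , + 1 , + 1 ⟩
      is1/ρ″ : Neighbour ⟨ -[1+ 0 ] , -[1+ 0 ] , + 0 ⟩

    private
      ∣a+_∣>4 : ∀ n → ¬ ∣ a + + n ∣ ℕ.≤ 4
      ∣a+ n ∣>4 = go 7≤a
        where
        go : ∀ {a} → + 7 ≤ a → ¬ ∣ a + + n ∣ ℕ.≤ 4
        go (+≤+ (s≤s (s≤s (s≤s (s≤s (s≤s _)))))) (s≤s (s≤s (s≤s (s≤s ()))))

      norm[x+ρ]≡1 : ∀ x → norm ⟨ x , + 1 , + 0 ⟩ ≡ + 1 → x ≡ + 0
      norm[x+ρ]≡1 x eq = [ (λ x≡0 → x≡0) , (λ q → contradiction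
          (subst (λ t → ∣ t ∣ ℕ.≤ 4) diff (ij≡2⇒∣j-i∣≤4 (x - + 1) (x + a + + 1)
              (trans quad (cong (_+ + 2) q)))) (∣a+ 2 ∣>4)) ]′
        (i*j≡0⇒i≡0∨j≡0 x (trans factor (cong (_- + 1) eq)))
        where
        factor : x * (x * x + a * x - a - + 3) ≡ norm ⟨ x , + 1 , + 0 ⟩ - + 1
        factor = solve 2 (λ a x → x :* (x :* x :+ a :* x :- a :- con (+ 3)) :=
          Cubic.norm (polyRing 2) a ⟨ x , con (+ 1) , con (+ 0) ⟩ :- con (+ 1)) refl a x
        quad : (x - + 1) * (x + a + + 1) ≡ x * x + a * x - a - + 3 + + 2
        quad = solve 2 (λ a x → (x :- con (+ 1)) :* (x :+ a :+ con (+ 1)) :=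
            x :* x :+ a :* x :- a :- con (+ 3) :+ con (+ 2)) refl a x
        diff : (x + a + + 1) - (x - + 1) ≡ a + + 2
        diff = solve 2 (λ a x → (x :+ a :+ con (+ 1)) :- (x :- con (+ 1)) := a :+ con (+ 2)) refl a
            x

      norm[x-ρ]≡1 : ∀ x → norm ⟨ x , -[1+ 0 ] , + 0 ⟩ ≡ + 1 → x ≡ -[1+ 0 ]
      norm[x-ρ]≡1 x eq = [ i+1≡0⇒ x , (λ q → contradiction
          (subst (λ t → ∣ t ∣ ℕ.≤ 4) diff (ij≡2⇒∣j-i∣≤4 (x - a - + 1) x
              (trans quad (cong (_+ + 2) q)))) (∣a+ 1 ∣>4)) ]′
        (i*j≡0⇒i≡0∨j≡0 (x + + 1) (trans factor (cong (_- + 1) eq)))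
        where
        i+1≡0⇒ : ∀ i → i + + 1 ≡ + 0 → i ≡ -[1+ 0 ]
        i+1≡0⇒ i eq = trans (solve 1 (λ i → i := i :+ con (+ 1) :- con (+ 1)) refl i)
            (cong (_- + 1) eq)
        factor : (x + + 1) * (x * x - (a + + 1) * x - + 2) ≡ norm ⟨ x , -[1+ 0 ] , + 0 ⟩ - + 1
        factor = solve 2 (λ a x → (x :+ con (+ 1)) :* (x :* x :- (a :+ con (+ 1)) :* x :- con (+ 2))
            :=
          Cubic.norm (polyRing 2) a ⟨ x , con -[1+ 0 ] , con (+ 0) ⟩ :- con (+ 1)) refl a x
        quad : (x - a - + 1) * x ≡ x * x - (a + + 1) * x - + 2 + + 2
        quad = solve 2 (λ a x → (x :- a :- con (+ 1)) :* x :=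
            x :* x :- (a :+ con (+ 1)) :* x :- con (+ 2) :+ con (+ 2)) refl a x
        diff : x - (x - a - + 1) ≡ a + + 1
        diff = solve 2 (λ a x → x :- (x :- a :- con (+ 1)) := a :+ con (+ 1)) refl a x

      norm[x+cρ′] : ∀ x c → norm ⟨ x , + 0 , c ⟩ ≡ norm ⟨ x , c , + 0 ⟩
      norm[x+cρ′] x c = solve 3 (λ a x c →
        Cubic.norm (polyRing 3) a ⟨ x , con (+ 0) , c ⟩ := Cubic.norm (polyRing 3) a ⟨ x , c ,
            con (+ 0) ⟩) refl a x c

      norm[x+ρ″] : ∀ x → norm ⟨ x , -[1+ 0 ] , -[1+ 0 ] ⟩ ≡ norm ⟨ x - a , + 1 , + 0 ⟩
      norm[x+ρ″] x = solve 2 (λ a x →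
        Cubic.norm (polyRing 2) a ⟨ x , con -[1+ 0 ] , con -[1+ 0 ] ⟩ :=
            Cubic.norm (polyRing 2) a ⟨ x :- a , con (+ 1) , con (+ 0) ⟩) refl a x

      norm[x-ρ″] : ∀ x → norm ⟨ x , + 1 , + 1 ⟩ ≡ norm ⟨ x + a , -[1+ 0 ] , + 0 ⟩
      norm[x-ρ″] x = solve 2 (λ a x →
        Cubic.norm (polyRing 2) a ⟨ x , con (+ 1) , con (+ 1) ⟩ :=
            Cubic.norm (polyRing 2) a ⟨ x :+ a , con -[1+ 0 ] , con (+ 0) ⟩) refl a x

      norm[x] : ∀ x → norm ⟨ x , + 0 , + 0 ⟩ ≡ x * x * x
      norm[x] x = solve 2 (λ a x → Cubic.norm (polyRing 2) a ⟨ x , con (+ 0) , con (+ 0) ⟩ :=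
          x :* x :* x) refl a x

      at : ∀ {x x₀ b c} → x ≡ x₀ → Neighbour ⟨ x₀ , b , c ⟩ → Neighbour ⟨ x , b , c ⟩
      at refl p = p

      ∣≤1∣ : ℤ → Set
      ∣≤1∣ i = i ≡ + 0 ⊎ i ≡ + 1 ⊎ i ≡ -[1+ 0 ]

      cases : ∀ x b c → ∣≤1∣ b → ∣≤1∣ c → form b c < + 3 → norm ⟨ x , b , c ⟩ ≡ + 1 →
          Neighbour ⟨ x , b , c ⟩
      cases x _ _ (inj₁ refl) (inj₁ refl) _ N≡1 =
        at (cube≡1⇒≡1 x (trans (sym (norm[x] x)) N≡1)) isOne
      cases x _ _ (inj₁ refl) (inj₂ (inj₁ refl)) _ N≡1 =
        at (norm[x+ρ]≡1 x (trans (sym (norm[x+cρ′] x (+ 1))) N≡1)) isρ′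
      cases x _ _ (inj₁ refl) (inj₂ (inj₂ refl)) _ N≡1 =
        at (norm[x-ρ]≡1 x (trans (sym (norm[x+cρ′] x -[1+ 0 ])) N≡1)) is1/ρ
      cases x _ _ (inj₂ (inj₁ refl)) (inj₁ refl) _ N≡1 = at (norm[x+ρ]≡1 x N≡1) isρ
      cases x _ _ (inj₂ (inj₁ refl)) (inj₂ (inj₁ refl)) _ N≡1 =
        at (trans (solve 2 (λ a x → x := x :+ a :- a) refl a x)
             (cong (_- a) (norm[x-ρ]≡1 (x + a) (trans (sym (norm[x-ρ″] x)) N≡1)))) is1/ρ′
      cases x _ _ (inj₂ (inj₁ refl)) (inj₂ (inj₂ refl)) h<3 _ = contradiction h<3 (<-irrefl refl)
      cases x _ _ (inj₂ (inj₂ refl)) (inj₁ refl) _ N≡1 = at (norm[x-ρ]≡1 x N≡1) is1/ρ″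
      cases x _ _ (inj₂ (inj₂ refl)) (inj₂ (inj₁ refl)) h<3 _ = contradiction h<3 (<-irrefl refl)
      cases x _ _ (inj₂ (inj₂ refl)) (inj₂ (inj₂ refl)) _ N≡1 =
        at (trans (solve 2 (λ a x → x := x :- a :+ a) refl a x)
             (trans (cong (_+ a) (norm[x+ρ]≡1 (x - a) (trans (sym (norm[x+ρ″] x)) N≡1)))
                 (+-identityˡ a))) isρ″

    neighbours : ∀ α → norm α ≡ + 1 → h α < + 3 → Neighbour α
    neighbours ⟨ x , b , c ⟩ N≡1 h<3 = cases x b c
      (∣i∣≤1⇒ b (form<3⇒∣c∣≤1 c b (subst (_< + 3) (form-sym b c) h<3)))
      (∣i∣≤1⇒ c (form<3⇒∣c∣≤1 b c h<3)) h<3 N≡1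

-- Ordered rings

record OrderedRing : Set₁ where
  field commutativeRing : CommutativeRing 0ℓ 0ℓ
  open CommutativeRing commutativeRing public
  infix 4 _<_
  field
    _<_          : Carrier → Carrier → Set
    <-resp       : ∀ {x x′ y y′} → x ≈ x′ → y ≈ y′ → x < y → x′ < y′
    <-irrefl     : ∀ {x} → ¬ x < x
    <-trans      : ∀ {x y z} → x < y → y < z → x < z
    <-cotrans    : ∀ {x y} → x < y → ∀ z → x < z ⊎ z < y
    <-tight      : ∀ {x y} → ¬ x < y → ¬ y < x → x ≈ y
    +-monoʳ-<    : ∀ z {x y} → x < y → z + x < z + y
    *-pos        : ∀ {x y} → 0# < x → 0# < y → 0# < x * y
    *-cancel-pos : ∀ {x y} → 0# < x → 0# < x * y → 0# < y
    ι            : ℤ → Carrier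
    ι-+          : ∀ i j → ι (i ℤ.+ j) ≈ ι i + ι j
    ι-*          : ∀ i j → ι (i ℤ.* j) ≈ ι i * ι j
    ι-neg        : ∀ i → ι (ℤ.- i) ≈ - ι i
    ι-0          : ι (+ 0) ≈ 0#
    ι-1          : ι (+ 1) ≈ 1#
    ι-mono-<     : ∀ {i j} → i ℤ.< j → ι i < ι j

module OrderedRingTheory (F : OrderedRing) where

  open IntegerCoordinates
  open OrderedRing F hiding (zero)
  open Triple

  ι-morphism : ℤ.+-*-rawRing -Raw-AlmostCommutative⟶ fromCommutativeRing commutativeRing
  ι-morphism = record
    { ⟦_⟧ = ι ; +-homo = ι-+ ; *-homo = ι-* ; -‿homo = ι-neg ; 0-homo = ι-0 ; 1-homo = ι-1 }

  ι-≟ : ∀ i j → Maybe (ι i ≈ ι j)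
  ι-≟ i j with i ℤ.≟ j
  ... | yes i≡j = just (reflexive (≡.cong ι i≡j))
  ... | no  _   = nothing

  module Solver = Algebra.Solver.Ring ℤ.+-*-rawRing (fromCommutativeRing commutativeRing) ι-morphism
      ι-≟
  open Solver using (Polynomial; solve; _:=_; con; _:+_; _:*_; :-_; _:-_)

  infix 4 0<_
  0<_ : Carrier → Set
  0< x = ι (+ 0) < x

  ι0<⇒ : ∀ {x} → 0< x → 0# < x
  ι0<⇒ = <-resp ι-0 refl

  ⇒ι0< : ∀ {x} → 0# < x → 0< x
  ⇒ι0< = <-resp (sym ι-0) refl

  module _ {x y : Carrier} where
    x<y⇒0<y-x : x < y → 0< y - x
    x<y⇒0<y-x x<y = <-resp (solve 1 (λ x → :- x :+ x := con (+ 0)) refl x) (+-comm (- x) y)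
        (+-monoʳ-< (- x) x<y)

    <-by : ∀ {s} → 0< s → s ≈ y - x → x < y
    <-by {s} 0<s eq = <-resp (solve 1 (λ x → x :+ con (+ 0) := x) refl x)
      (trans (+-congˡ eq) (solve 2 (λ x y → x :+ (y :- x) := y) refl x y)) (+-monoʳ-< x 0<s)

    pos-+ : 0< x → 0< y → 0< x + y
    pos-+ 0<x 0<y = <-trans 0<x (<-resp (solve 1 (λ x → x :+ con (+ 0) := x) refl x) refl
        (+-monoʳ-< x 0<y))

    pos-* : 0< x → 0< y → 0< x * y
    pos-* 0<x 0<y = ⇒ι0< (*-pos (ι0<⇒ 0<x) (ι0<⇒ 0<y))

    pos-cancel : 0< x → 0< x * y → 0< y
    pos-cancel 0<x 0<xy = ⇒ι0< (*-cancel-pos (ι0<⇒ 0<x) (ι0<⇒ 0<xy))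

  0<⇒≉0 : ∀ {x} → 0< x → ¬ x ≈ ι (+ 0)
  0<⇒≉0 0<x x≈0 = <-irrefl (<-resp refl x≈0 0<x)

  pos-ι : ∀ n → 0< ι (+ ℕ.suc n)
  pos-ι n = ι-mono-< (ℤ.+<+ (s≤s z≤n))

  ι-injective : ∀ {i j} → ι i ≈ ι j → i ≡ j
  ι-injective {i} {j} eq with ℤ.<-cmp i j
  ... | tri< i<j _ _ = contradiction (<-resp eq refl (ι-mono-< i<j)) <-irrefl
  ... | tri≈ _ i≡j _ = i≡j
  ... | tri> _ _ j<i = contradiction (<-resp refl eq (ι-mono-< j<i)) <-irrefl

  ι-cancel-< : ∀ {i j} → ι i < ι j → i ℤ.< j
  ι-cancel-< {i} {j} lt with ℤ.<-cmp i j
  ... | tri< i<j _ _ = i<j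
  ... | tri≈ _ ≡.refl _ = contradiction lt <-irrefl
  ... | tri> _ _ j<i = contradiction (<-trans lt (ι-mono-< j<i)) <-irrefl

  cancel-≈0 : ∀ {x y} → 0< x → x * y ≈ ι (+ 0) → y ≈ ι (+ 0)
  cancel-≈0 {x} {y} 0<x xy≈0 = <-tight
    (λ y<0 → 0<⇒≉0 (pos-* 0<x (x<y⇒0<y-x y<0))
      (trans (solve 2 (λ x y → x :* (con (+ 0) :- y) := :- (x :* y)) refl x y)
          (trans (-‿cong xy≈0) (sym (ι-neg (+ 0))))))
    (λ 0<y → 0<⇒≉0 (pos-* 0<x 0<y) xy≈0)

  <-+ : ∀ {x x′ y y′} → x < x′ → y < y′ → x + y < x′ + y′
  <-+ {x} {x′} {y} {y′} x<x′ y<y′ = <-by (pos-+ (x<y⇒0<y-x x<x′) (x<y⇒0<y-x y<y′))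
    (solve 4 (λ x x′ y y′ → (x′ :- x) :+ (y′ :- y) := (x′ :+ y′) :- (x :+ y)) refl x x′ y y′)

  <-* : ∀ {x x′ y y′} → 0< x → x < x′ → 0< y → y < y′ → x * y < x′ * y′
  <-* {x} {x′} {y} {y′} 0<x x<x′ 0<y y<y′ =
    <-by (pos-+ (pos-* (x<y⇒0<y-x x<x′) (<-trans 0<y y<y′)) (pos-* 0<x (x<y⇒0<y-x y<y′)))
    (solve 4 (λ x x′ y y′ → (x′ :- x) :* y′ :+ x :* (y′ :- y) := (x′ :* y′) :- (x :* y)) refl x x′ y
        y′)

  <-*ˡ : ∀ {x y y′} → 0< x → y < y′ → x * y < x * y′
  <-*ˡ {x} {y} {y′} 0<x y<y′ = <-by (pos-* 0<x (x<y⇒0<y-x y<y′))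
    (solve 3 (λ x y y′ → x :* (y′ :- y) := x :* y′ :- x :* y) refl x y y′)

  <-cancelˡ : ∀ {x y y′} → 0< x → x * y < x * y′ → y < y′
  <-cancelˡ {x} {y} {y′} 0<x lt = <-by (pos-cancel 0<x (<-resp refl
    (solve 3 (λ x y y′ → x :* y′ :- x :* y := x :* (y′ :- y)) refl x y y′) (x<y⇒0<y-x lt))) refl

  ≈-by : ∀ {x y} c {u} → u ≈ ι (+ 0) → x ≈ y + c * u → x ≈ y
  ≈-by {x} {y} c {u} u≈0 eq = trans eq (trans (+-congˡ (*-congˡ u≈0))
    (solve 2 (λ y c → y :+ c :* con (+ 0) := y) refl y c))

  x≈y⇒x-y≈0 : ∀ {x y} → x ≈ y → x - y ≈ ι (+ 0)
  x≈y⇒x-y≈0 {x} {y} eq = trans (+-congʳ eq) (solve 1 (λ y → y :- y := con (+ 0)) refl y)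

  x-y≈0⇒x≈y : ∀ {x y} → x - y ≈ ι (+ 0) → x ≈ y
  x-y≈0⇒x≈y {x} {y} eq = ≈-by (ι (+ 1)) eq (solve 2 (λ x y → x := y :+ con (+ 1) :* (x :- y)) refl x
      y)

  data Expr (n : ℕ) : Set where
    lit : ℤ → Expr n
    var : Fin n → Expr n
    _⊞_ _⊠_ : Expr n → Expr n → Expr n
    ⊟_ : Expr n → Expr n

  exprRing : ℕ → RawRing 0ℓ 0ℓ
  exprRing n = record
    { Carrier = Expr n ; _≈_ = _≡_ ; _+_ = _⊞_ ; _*_ = _⊠_ ; -_ = ⊟_ ; 0# = lit (+ 0) ; 1# =
        lit (+ 1) }

  ⟦_⟧ℤ : ∀ {n} → Expr n → Vec ℤ n → ℤ
  ⟦ lit i ⟧ℤ env = i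
  ⟦ var x ⟧ℤ env = lookup env x
  ⟦ e ⊞ f ⟧ℤ env = ⟦ e ⟧ℤ env ℤ.+ ⟦ f ⟧ℤ env
  ⟦ e ⊠ f ⟧ℤ env = ⟦ e ⟧ℤ env ℤ.* ⟦ f ⟧ℤ env
  ⟦ ⊟ e ⟧ℤ env = ℤ.- ⟦ e ⟧ℤ env

  ⟦_⟧ : ∀ {n} → Expr n → Vec ℤ n → Carrier
  ⟦ lit i ⟧ env = ι i
  ⟦ var x ⟧ env = ι (lookup env x)
  ⟦ e ⊞ f ⟧ env = ⟦ e ⟧ env + ⟦ f ⟧ env
  ⟦ e ⊠ f ⟧ env = ⟦ e ⟧ env * ⟦ f ⟧ env
  ⟦ ⊟ e ⟧ env = - ⟦ e ⟧ env

  ι-⟦⟧ : ∀ {n} (e : Expr n) env → ι (⟦ e ⟧ℤ env) ≈ ⟦ e ⟧ env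
  ι-⟦⟧ (lit i) env = refl
  ι-⟦⟧ (var x) env = refl
  ι-⟦⟧ (e ⊞ f) env = trans (ι-+ (⟦ e ⟧ℤ env) (⟦ f ⟧ℤ env)) (+-cong (ι-⟦⟧ e env) (ι-⟦⟧ f env))
  ι-⟦⟧ (e ⊠ f) env = trans (ι-* (⟦ e ⟧ℤ env) (⟦ f ⟧ℤ env)) (*-cong (ι-⟦⟧ e env) (ι-⟦⟧ f env))
  ι-⟦⟧ (⊟ e) env = trans (ι-neg (⟦ e ⟧ℤ env)) (-‿cong (ι-⟦⟧ e env))

  rPoly : ℕ → RawRing 0ℓ 0ℓ
  rPoly n = record { Carrier = Polynomial n ; _≈_ = _≡_ ; _+_ = _:+_ ; _*_ = _:*_ ; -_ = :-_ ; 0# =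
      con (+ 0) ; 1# = con (+ 1) }

  eval : List ℤ → Carrier → Carrier
  eval p x = foldr (λ c r → ι c + x * r) (ι (+ 0)) p

  module Embedding (a : ℤ) where
    private A = ι a
    open Order a

    record Cyclic (r r′ r″ : Carrier) : Set where
      field
        r+r′+r″ : r + r′ + r″ ≈ A
        rr′     : r * r′ ≈ - ι (+ 1) - r
        r′r″    : r′ * r″ ≈ - ι (+ 1) - r′
        r″r     : r″ * r ≈ - ι (+ 1) - r″

    rotate : ∀ {r r′ r″} → Cyclic r r′ r″ → Cyclic r′ r″ r
    rotate {r} {r′} {r″} C = record
      { r+r′+r″ = trans (solve 3 (λ r r′ r″ → r′ :+ r″ :+ r := r :+ r′ :+ r″) refl r r′ r″) r+r′+r″
      ; rr′ = r′r″ ; r′r″ = r″r ; r″r = rr′ }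
      where open Cyclic C

    reduce : List ℤ → Triple ℤ
    reduce []      = constant (+ 0)
    reduce (c ∷ p) = constant c ∔ ⟨ + 0 , + 1 , + 0 ⟩ · reduce p

    φ : Carrier → Carrier → Triple ℤ → Carrier
    φ r r′ ⟨ x , b , c ⟩ = ι x + ι b * r + ι c * r′

    module _ {r r′ r″} (C : Cyclic r r′ r″) where
      open Cyclic C

      r² : r * r ≈ A + ι (+ 2) + A * r - r′
      r² = ≈-by r (x≈y⇒x-y≈0 r+r′+r″) (≈-by (- ι (+ 1)) (x≈y⇒x-y≈0 rr′)
          (≈-by (- ι (+ 1)) (x≈y⇒x-y≈0 r″r)
        (≈-by (ι (+ 1)) (x≈y⇒x-y≈0 r+r′+r″)
        (solve 4 (λ A r r′ r″ → r :* r := A :+ con (+ 2) :+ A :* r :- r′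
          :+ r :* (r :+ r′ :+ r″ :- A) :+ :- con (+ 1) :* (r :* r′ :- (:- con (+ 1) :- r))
          :+ :- con (+ 1) :* (r″ :* r :- (:- con (+ 1) :- r″)) :+ con (+ 1) :* (r :+ r′ :+ r″ :- A))
              refl A r r′ r″))))

    module _ {r r′ r″} (C : Cyclic r r′ r″) where
      open Cyclic C

      r′² : r′ * r′ ≈ ι (+ 2) + r + (A + ι (+ 1)) * r′
      r′² = trans (r² (rotate C)) (≈-by (- ι (+ 1)) (x≈y⇒x-y≈0 r+r′+r″)
        (solve 4 (λ A r r′ r″ → A :+ con (+ 2) :+ A :* r′ :- r″ :=
          con (+ 2) :+ r :+ (A :+ con (+ 1)) :* r′ :+ :- con (+ 1) :* (r :+ r′ :+ r″ :- A)) refl A r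
              r′ r″))

      φ-· : ∀ α β → φ r r′ (α · β) ≈ φ r r′ α * φ r r′ β
      φ-· ⟨ x , b , c ⟩ ⟨ y , d , e ⟩ = trans
        (+-cong (+-cong (ι-⟦⟧ (c₁ E) env) (*-congʳ (ι-⟦⟧ (cρ E) env))) (*-congʳ (ι-⟦⟧ (cρ′ E) env)))
        (≈-by (- (ι b * ι d)) (x≈y⇒x-y≈0 (r² C)) (≈-by (- (ι b * ι e + ι c * ι d)) (x≈y⇒x-y≈0 rr′)
          (≈-by (- (ι c * ι e)) (x≈y⇒x-y≈0 r′²)
        (solve 9 (λ A x b c y d e r r′ →
            let open Cubic (rPoly 9) A renaming (_·_ to _·′_); P = ⟨ x , b , c ⟩ ·′ ⟨ y , d , e ⟩ in
          c₁ P :+ cρ P :* r :+ cρ′ P :* r′ :=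
          (x :+ b :* r :+ c :* r′) :* (y :+ d :* r :+ e :* r′)
          :+ :- (b :* d) :* (r :* r :- (A :+ con (+ 2) :+ A :* r :- r′))
          :+ :- (b :* e :+ c :* d) :* (r :* r′ :- (:- con (+ 1) :- r))
          :+ :- (c :* e) :* (r′ :* r′ :- (con (+ 2) :+ r :+ (A :+ con (+ 1)) :* r′))) refl A (ι x)
              (ι b) (ι c) (ι y) (ι d) (ι e) r r′))))
        where
        env : Vec ℤ 7
        env = a ∷ x ∷ b ∷ c ∷ y ∷ d ∷ e ∷ []
        E : Triple (Expr 7)
        E = Cubic._·_ (exprRing 7) (var (# 0)) ⟨ var (# 1) , var (# 2) , var (# 3) ⟩
          ⟨ var (# 4) , var (# 5) , var (# 6) ⟩

      φ-∔ : ∀ α β → φ r r′ (α ∔ β) ≈ φ r r′ α + φ r r′ β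
      φ-∔ ⟨ x , b , c ⟩ ⟨ y , d , e ⟩ = trans
        (+-cong (+-cong (ι-+ x y) (*-congʳ (ι-+ b d))) (*-congʳ (ι-+ c e)))
        (solve 8 (λ x b c y d e r r′ → x :+ y :+ (b :+ d) :* r :+ (c :+ e) :* r′ :=
          x :+ b :* r :+ c :* r′ :+ (y :+ d :* r :+ e :* r′)) refl (ι x) (ι b) (ι c) (ι y) (ι d)
              (ι e) r r′)

      φ-constant : ∀ x → φ r r′ (constant x) ≈ ι x
      φ-constant x = solve 3 (λ x r r′ → x :+ con (+ 0) :* r :+ con (+ 0) :* r′ := x) refl (ι x) r
          r′

      φ-σ : ∀ α → φ r r′ (σ α) ≈ φ r′ r″ α
      φ-σ ⟨ x , b , c ⟩ = trans
        (+-cong (+-cong (trans (ι-+ x (c ℤ.* a)) (+-congˡ (ι-* c a))) (*-congʳ (ι-neg c)))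
          (*-congʳ (trans (ι-+ b (ℤ.- c)) (+-congˡ (ι-neg c)))))
        (≈-by (- ι c) (x≈y⇒x-y≈0 r+r′+r″)
          (solve 7 (λ A x b c r r′ r″ → x :+ c :* A :+ :- c :* r :+ (b :+ :- c) :* r′ :=
            x :+ b :* r′ :+ c :* r″ :+ :- c :* (r :+ r′ :+ r″ :- A)) refl A (ι x) (ι b) (ι c) r r′
                r″))

      eval≈φ : ∀ p → eval p r ≈ φ r r′ (reduce p)
      eval≈φ []      = sym (φ-constant (+ 0))
      eval≈φ (c ∷ p) = sym (trans (φ-∔ (constant c) _) (+-cong (φ-constant c)
        (trans (φ-· _ (reduce p)) (*-cong
          (solve 2 (λ r r′ → con (+ 0) :+ con (+ 1) :* r :+ con (+ 0) :* r′ := r) refl r r′)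
              (sym (eval≈φ p))))))

  private
    k : ℕ → Carrier
    k n = ι (+ n)
    κ : ∀ {n} → ℕ → Polynomial n
    κ n = con (+ n)

  pos+ℕ* : ∀ {x y} n → 0< x → 0< y → 0< x + k n * y
  pos+ℕ* {x} {y} ℕ.zero 0<x 0<y = <-resp refl (solve 2 (λ x y → x := x :+ con (+ 0) :* y) refl x y)
      0<x
  pos+ℕ* (suc n) 0<x 0<y = pos-+ 0<x (pos-* (pos-ι n) 0<y)

  energy : Carrier → Carrier → Carrier → Carrier
  energy x y z = x * x + y * y + z * z - (x * y + y * z + z * x)

  -- Replacing each x² by the larger Yx makes Y³ − Y·energy multilinear and zero at every
  -- vertex of the cube [0,Y]³ except (0,0,0) and (Y,Y,Y), so it becomes a sum of two products.
  energy-pos-< : ∀ Y {x y z} → 0< Y → 0< x → x < Y → 0< y → y < Y → 0< z → z < Y →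
      energy x y z < Y * Y
  energy-pos-< Y {x} {y} {z} 0<Y 0<x x<Y 0<y y<Y 0<z z<Y = <-cancelˡ 0<Y (<-by
    (pos-+ (pos-+ (pos-* (pos-* 0<x 0<y) 0<z) (pos-* (pos-* 0<Y-x 0<Y-y) 0<Y-z))
      (pos-* 0<Y (pos-+ (pos-+ (pos-* 0<x 0<Y-x) (pos-* 0<y 0<Y-y)) (pos-* 0<z 0<Y-z))))
    (solve 4 (λ x y z Y → x :* y :* z :+ (Y :- x) :* (Y :- y) :* (Y :- z)
        :+ Y :* (x :* (Y :- x) :+ y :* (Y :- y) :+ z :* (Y :- z)) :=
        Y :* (Y :* Y) :- Y :* (x :* x :+ y :* y :+ z :* z :- (x :* y :+ y :* z :+ z :* x))) refl x y
            z Y))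
    where
    0<Y-x = x<y⇒0<y-x x<Y
    0<Y-y = x<y⇒0<y-x y<Y
    0<Y-z = x<y⇒0<y-x z<Y

  energy-box-< : ∀ X Y Z {x y z} → 0< x → x < X → 0< y → y < Y → 0< z → z < Z →
    energy x (- y) (- z) < X * X + Y * Y + Z * Z + X * Y + X * Z
  energy-box-< X Y Z {x} {y} {z} 0<x x<X 0<y y<Y 0<z z<Z = <-by
    (pos-+ (pos-+ (pos-+
      (pos-* (x<y⇒0<y-x x<X) (pos-+ (pos-+ (pos-+ 0<X 0<x) 0<y) 0<z))
      (pos-* (x<y⇒0<y-x y<Y) (pos-+ (pos-+ 0<Y 0<y) 0<X)))
      (pos-* (x<y⇒0<y-x z<Z) (pos-+ (pos-+ 0<Z 0<z) 0<X)))
      (pos-* 0<y 0<z))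
    (solve 6 (λ x y z X Y Z →
      (X :- x) :* (X :+ x :+ y :+ z) :+ (Y :- y) :* (Y :+ y :+ X) :+ (Z :- z) :* (Z :+ z :+ X) :+ y
          :* z :=
      X :* X :+ Y :* Y :+ Z :* Z :+ X :* Y :+ X :* Z :-
      (x :* x :+ :- y :* :- y :+ :- z :* :- z :- (x :* :- y :+ :- y :* :- z :+ :- z :* x))) refl x y
          z X Y Z)
    where
    0<X = <-trans 0<x x<X
    0<Y = <-trans 0<y y<Y
    0<Z = <-trans 0<z z<Z

  -- p = ρ, q = −ρ′ and s = −ρ″, which makes all three positive.
  record Location (A p q s : Carrier) : Set where
    field
      69<10A  : 0< k 10 * A - k 69
      A+1<p   : A + k 1 < p
      0<s     : 0< s
      pq      : p * q ≈ k 1 + p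
      qs      : q * s ≈ q - k 1
      ps      : p * s ≈ k 1 - s
      p≈A+q+s : p ≈ A + q + s

  module Estimates {A p q s : Carrier} (L : Location A p q s) where
    open Location L public

    -- Expanding in 10A − 69 instead of A − 7 keeps the hypothesis a ≥ 7 a strict inequality.
    A-< : ∀ N c₀ c₁ c₂ {x y} →
      k (suc N) * (y - x) ≈ k (suc c₀) + k c₁ * (k 10 * A - k 69) + k c₂ *
          ((k 10 * A - k 69) * (k 10 * A - k 69)) → x < y
    A-< N c₀ c₁ c₂ eq = <-by (pos-cancel (pos-ι N) (<-resp refl (sym eq)
      (pos+ℕ* c₂ (pos+ℕ* c₁ (pos-ι c₀) 69<10A) (pos-* 69<10A 69<10A)))) refl

    private
      K : ∀ {n} → Polynomial n → Polynomial n
      K A = κ 10 :* A :- κ 69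
      Q : ∀ {n} → ℕ → ℕ → ℕ → Polynomial n → Polynomial n
      Q c₀ c₁ c₂ A = κ (suc c₀) :+ κ c₁ :* K A :+ κ c₂ :* (K A :* K A)

    0<A-1 : 0< A - k 1
    0<A-1 = A-< 9 58 1 0 (solve 1 (λ A → κ 10 :* (A :- κ 1 :- con (+ 0)) := Q 58 1 0 A) refl A)

    0<A+ : ∀ n → 0< A + k n
    0<A+ n = pos-cancel (pos-ι 9) (<-resp refl
        (solve 2 (λ A n → κ 69 :+ (κ 10 :* A :- κ 69) :+ κ 10 :* n := κ 10 :* (A :+ n)) refl A
        (k n))
      (pos+n (pos-+ (pos-ι 68) 69<10A)))
      where
      pos+n : ∀ {x} → 0< x → 0< x + k 10 * k n
      pos+n {x} 0<x = <-resp refl (+-congˡ (*-comm (k n) (k 10))) (pos+ℕ* n 0<x (pos-ι 9))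

    0<A-2 : 0< A - k 2
    0<A-2 = A-< 9 48 1 0 (solve 1 (λ A → κ 10 :* (A :- κ 2 :- con (+ 0)) := Q 48 1 0 A) refl A)

    0<p : 0< p
    0<p = <-trans (0<A+ 1) A+1<p

    0<1+p : 0< k 1 + p
    0<1+p = pos-+ (pos-ι 0) 0<p

    0<q : 0< q
    0<q = pos-cancel 0<p (<-resp refl (sym pq) 0<1+p)

    0<q-1 : 0< q - k 1
    0<q-1 = <-resp refl qs (pos-* 0<q 0<s)

    0<1-s : 0< k 1 - s
    0<1-s = <-resp refl ps (pos-* 0<p 0<s)

    [q-1]p : (q - k 1) * p ≈ k 1
    [q-1]p = ≈-by (k 1) (x≈y⇒x-y≈0 pq)
      (solve 2 (λ p q → (q :- κ 1) :* p := κ 1 :+ κ 1 :* (p :* q :- (κ 1 :+ p))) refl p q)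

    s[1+p] : s * (k 1 + p) ≈ k 1
    s[1+p] = ≈-by (k 1) (x≈y⇒x-y≈0 ps)
      (solve 2 (λ p s → s :* (κ 1 :+ p) := κ 1 :+ κ 1 :* (p :* s :- (κ 1 :- s))) refl p s)

    [q-1][A+1]<1 : (q - k 1) * (A + k 1) < k 1
    [q-1][A+1]<1 = <-resp refl [q-1]p (<-*ˡ 0<q-1 A+1<p)

    A+2<1+p : A + k 2 < k 1 + p
    A+2<1+p = <-by (x<y⇒0<y-x A+1<p) (solve 2 (λ A p → p :- (A :+ κ 1) := κ 1 :+ p :- (A :+ κ 2))
        refl A p)

    s[A+2]<1 : s * (A + k 2) < k 1
    s[A+2]<1 = <-resp refl s[1+p] (<-*ˡ 0<s A+2<1+p)

    s[A+1]<1 : s * (A + k 1) < k 1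
    s[A+1]<1 = <-trans (<-*ˡ 0<s (<-by (pos-ι 0)
        (solve 1 (λ A → κ 1 := A :+ κ 2 :- (A :+ κ 1)) refl A))) s[A+2]<1

    7[q-1]<1 : (q - k 1) * k 7 < k 1
    7[q-1]<1 = <-trans (<-*ˡ 0<q-1 (A-< 9 8 1 0
        (solve 1 (λ A → κ 10 :* (A :+ κ 1 :- κ 7) := Q 8 1 0 A) refl A))) [q-1][A+1]<1

    7s<1 : s * k 7 < k 1
    7s<1 = <-trans (<-*ˡ 0<s
        (A-< 9 8 1 0 (solve 1 (λ A → κ 10 :* (A :+ κ 1 :- κ 7) := Q 8 1 0 A) refl A))) s[A+1]<1

    d : Carrier
    d = p - (A + k 1)

    d≈ : d ≈ (q - k 1) + s
    d≈ = ≈-by (k 1) (x≈y⇒x-y≈0 p≈A+q+s) (solve 4 (λ A p q s →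
      p :- (A :+ κ 1) := (q :- κ 1) :+ s :+ κ 1 :* (p :- (A :+ q :+ s))) refl A p q s)

    d[A+1]<2 : d * (A + k 1) < k 2
    d[A+1]<2 = <-resp (sym (trans (*-congʳ d≈) (distribʳ (A + k 1) (q - k 1) s)))
      (solve 0 (κ 1 :+ κ 1 := κ 2) refl) (<-+ [q-1][A+1]<1 s[A+1]<1)

    d<1 : d < k 1
    d<1 = <-cancelˡ (pos-ι 6) (<-by (pos-+ (pos-+ (x<y⇒0<y-x 7[q-1]<1) (x<y⇒0<y-x 7s<1)) (pos-ι 4))
      (≈-by (k 7) (x≈y⇒x-y≈0 d≈) (solve 3 (λ d q s →
        (κ 1 :- (q :- κ 1) :* κ 7) :+ (κ 1 :- s :* κ 7) :+ κ 5 :=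
        κ 7 :* κ 1 :- κ 7 :* d :+ κ 7 :* (d :- ((q :- κ 1) :+ s))) refl d q s)))

    p<A+2 : p < A + k 2
    p<A+2 = <-by (x<y⇒0<y-x d<1) (solve 2 (λ A p → κ 1 :- (p :- (A :+ κ 1)) := A :+ κ 2 :- p) refl A
        p)

    p[1+p]< : p * (k 1 + p) < A * A + k 3 * A + k 8
    p[1+p]< = <-by (pos-+ (pos-* (pos-ι 1) (x<y⇒0<y-x d[A+1]<2))
        (pos-* (x<y⇒0<y-x d<1) (pos-+ (pos-ι 1) (x<y⇒0<y-x A+1<p))))
      (solve 2 (λ A p → let d = p :- (A :+ κ 1) in
        κ 2 :* (κ 2 :- d :* (A :+ κ 1)) :+ (κ 1 :- d) :* (κ 2 :+ d) :=
        A :* A :+ κ 3 :* A :+ κ 8 :- p :* (κ 1 :+ p)) refl A p)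

    γ₁< : A + k 12 + (A + k 1) * p - (A - k 2) * q < (A + k 2) * (A + k 2)
    γ₁< = <-trans (<-by (pos-+ (x<y⇒0<y-x s[A+1]<1)
        (pos-+ (x<y⇒0<y-x 7[q-1]<1) (pos-* (pos-ι 3) 0<q-1)))
        (≈-by (A + k 1) (x≈y⇒x-y≈0 p≈A+q+s) (solve 4 (λ A p q s →
          (κ 1 :- s :* (A :+ κ 1)) :+ ((κ 1 :- (q :- κ 1) :* κ 7) :+ κ 4 :* (q :- κ 1)) :=
          A :* A :+ κ 2 :* A :+ κ 17 :- (A :+ κ 12 :+ (A :+ κ 1) :* p :- (A :- κ 2) :* q)
          :+ (A :+ κ 1) :* (p :- (A :+ q :+ s))) refl A p q s)))
      (A-< 9 7 2 0 (solve 1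
          (λ A → κ 10 :* ((A :+ κ 2) :* (A :+ κ 2) :- (A :* A :+ κ 2 :* A :+ κ 17)) := Q 7 2 0 A)
          refl A))

    γ₂< : A + k 12 - (A + k 1) * q - (A - k 2) * s < k 11
    γ₂< = <-by (pos-+ (pos-* (0<A+ 1) 0<q-1) (pos-* 0<A-2 0<s)) (solve 3 (λ A q s →
      (A :+ κ 1) :* (q :- κ 1) :+ (A :- κ 2) :* s :=
          κ 11 :- (A :+ κ 12 :- (A :+ κ 1) :* q :- (A :- κ 2) :* s)) refl A q s)

    γ₃< : A + k 12 - (A + k 1) * s + (A - k 2) * p < (A + k 1) * (A + k 1)
    γ₃< = <-trans (<-by (pos-+ (pos-* (pos-ι 2) 0<s)
        (pos-+ (x<y⇒0<y-x [q-1][A+1]<1) (pos-* (pos-ι 2) 0<q-1)))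
        (≈-by (A - k 2) (x≈y⇒x-y≈0 p≈A+q+s) (solve 4 (λ A p q s →
          κ 3 :* s :+ ((κ 1 :- (q :- κ 1) :* (A :+ κ 1)) :+ κ 3 :* (q :- κ 1)) :=
          A :* A :+ κ 11 :- (A :+ κ 12 :- (A :+ κ 1) :* s :+ (A :- κ 2) :* p)
          :+ (A :- κ 2) :* (p :- (A :+ q :+ s))) refl A p q s)))
      (A-< 99 379 20 0 (solve 1 (λ A → κ 100 :* (((A :+ κ 1) :* (A :+ κ 1)) :- (A :* A :+ κ 11)) :=
          Q 379 20 0 A) refl A))

    M : Carrier
    M = k 3 * (A * A + k 3 * A + k 9)

    module Bounds {e₁ e₂ e₃ : Carrier} (0<e₁ : 0< e₁) (0<e₂ : 0< e₂) (0<e₃ : 0< e₃)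
      (e₁e₂e₃ : e₁ * (e₂ * e₃) ≈ k 1)
      (e₁< : e₁ < (A + k 2) * (A + k 2)) (e₂< : e₂ < k 11) (e₃< : e₃ < (A + k 1) * (A + k 1))
      where

      shrink : ∀ {x y c} → 0< x → 0< c → x * c < k 1 → y < c * c → x * y < c
      shrink {x} {y} {c} 0<x 0<c xc<1 y<cc = <-trans (<-*ˡ 0<x y<cc)
        (<-resp (solve 2 (λ x c → c :* (x :* c) := x :* (c :* c)) refl x c)
            (solve 1 (λ c → c :* κ 1 := c) refl c) (<-*ˡ 0<c xc<1))

      [1-s]y< : ∀ {y c} → 0< y → y < c → (k 1 - s) * y < c
      [1-s]y< {y} {c} 0<y y<c = <-by (pos-+ (x<y⇒0<y-x y<c) (pos-* 0<s 0<y))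
        (solve 3 (λ y c s → c :- y :+ s :* y := c :- (κ 1 :- s) :* y) refl y c s)

      s*e₁< : s * e₁ < A + k 2
      s*e₁< = shrink 0<s (0<A+ 2) s[A+2]<1 e₁<

      s*e₃< : s * e₃ < A + k 1
      s*e₃< = shrink 0<s (0<A+ 1) s[A+1]<1 e₃<

      [q-1]*e₃< : (q - k 1) * e₃ < A + k 1
      [q-1]*e₃< = shrink 0<q-1 (0<A+ 1) [q-1][A+1]<1 e₃<

      [q-1]*e₁< : (q - k 1) * e₁ < A + k 4
      [q-1]*e₁< = <-trans (<-*ˡ 0<q-1 e₁<) (<-by
        (pos-+ (pos-+ (pos-* (x<y⇒0<y-x [q-1][A+1]<1) (0<A+ 3)) (x<y⇒0<y-x 7[q-1]<1))
            (pos-* (pos-ι 5) 0<q-1))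
        (solve 2 (λ A q → (κ 1 :- (q :- κ 1) :* (A :+ κ 1)) :* (A :+ κ 3) :+
            (κ 1 :- (q :- κ 1) :* κ 7) :+ κ 6 :* (q :- κ 1) :=
          A :+ κ 4 :- (q :- κ 1) :* ((A :+ κ 2) :* (A :+ κ 2))) refl A q))

      q*e₃< : e₃ < A → q * e₃ < A + k 1
      q*e₃< e₃<A = <-by
        (pos-+ (pos-+ (pos-+ (x<y⇒0<y-x e₃<A) (x<y⇒0<y-x [q-1][A+1]<1))
            (pos-* 0<q-1 (x<y⇒0<y-x e₃<A))) 0<q-1)
        (solve 3 (λ A q e → (A :- e) :+ (κ 1 :- (q :- κ 1) :* (A :+ κ 1)) :+ (q :- κ 1) :* (A :- e)
            :+ (q :- κ 1) :=
          A :+ κ 1 :- q :* e) refl A q e₃)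

      product : ∀ x y → x * y * (e₁ * (e₂ * e₃)) ≈ x * y
      product x y = trans (*-congˡ e₁e₂e₃) (solve 1 (λ x → x :* κ 1 := x) refl (x * y))

      p*e₁< : A - k 1 < e₃ → k 3 < (k 1 + p) * e₂ → p * e₁ < A - k 1
      p*e₁< <e₃ 3< = <-cancelˡ (pos-* (pos-ι 2) 0<A-1) (<-trans
        (<-resp (*-comm (p * e₁) (k 3 * (A - k 1)))
          (trans (solve 4 (λ p e₁ e₂ e₃ → p :* e₁ :* ((κ 1 :+ p) :* e₂ :* e₃) :=
              p :* (κ 1 :+ p) :* (e₁ :* (e₂ :* e₃))) refl p e₁ e₂ e₃)
            (product p (k 1 + p)))
          (<-*ˡ (pos-* 0<p 0<e₁) (<-* (pos-ι 2) 3< 0<A-1 <e₃)))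
        (<-trans p[1+p]< (A-< 99 2811 186 2 (solve 1
            (λ A → κ 100 :* ((κ 3 :* (A :- κ 1) :* (A :- κ 1)) :- (A :* A :+ κ 3 :* A :+ κ 8)) :=
            Q 2811 186 2 A) refl A))))

      [1+p]*e₃< : A - k 1 < e₁ → k 3 < p * e₂ → (k 1 + p) * e₃ < A - k 2
      [1+p]*e₃< <e₁ 3< = <-cancelˡ (pos-* (pos-ι 2) 0<A-1) (<-trans
        (<-resp (*-comm ((k 1 + p) * e₃) (k 3 * (A - k 1)))
          (trans (solve 4 (λ p e₁ e₂ e₃ → (κ 1 :+ p) :* e₃ :* (p :* e₂ :* e₁) :=
              p :* (κ 1 :+ p) :* (e₁ :* (e₂ :* e₃))) refl p e₁ e₂ e₃)
            (product p (k 1 + p)))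
          (<-*ˡ (pos-* 0<1+p 0<e₃) (<-* (pos-ι 2) 3< 0<A-1 <e₁)))
        (<-trans p[1+p]< (A-< 99 1041 156 2 (solve 1
            (λ A → κ 100 :* ((κ 3 :* (A :- κ 1) :* (A :- κ 2)) :- (A :* A :+ κ 3 :* A :+ κ 8)) :=
            Q 1041 156 2 A) refl A))))

      e₂<2 : ∀ {x y t} → A - k 1 < x → A + k 4 < y → e₂ * (x * y) ≈ t → t < A * A + k 4 * A + k 11 →
          e₂ < k 2
      e₂<2 <x <y eq t< = <-cancelˡ (pos-* 0<A-1 (0<A+ 4)) (<-trans
        (<-resp (*-comm e₂ ((A - k 1) * (A + k 4))) eq (<-*ˡ 0<e₂ (<-* 0<A-1 <x (0<A+ 4) <y)))
        (<-trans t< (A-< 99 4240 158 1 (solve 1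
            (λ A → κ 100 :* (((A :- κ 1) :* (A :+ κ 4) :* κ 2) :- (A :* A :+ κ 4 :* A :+ κ 11)) :=
            Q 4240 158 1 A) refl A))))

      e₂<2′ : A - k 1 < e₃ → A + k 4 < p * (p * e₁) → e₂ < k 2
      e₂<2′ <e₃ <τ = e₂<2 <e₃ <τ
        (trans (solve 4 (λ p e₁ e₂ e₃ → e₂ :* (e₃ :* (p :* (p :* e₁))) :=
            p :* p :* (e₁ :* (e₂ :* e₃))) refl p e₁ e₂ e₃) (product p p))
        (<-by (pos-+ (pos-+ (x<y⇒0<y-x p[1+p]<) (0<A+ 3)) 0<p) (solve 2 (λ A p →
          A :* A :+ κ 3 :* A :+ κ 8 :- p :* (κ 1 :+ p) :+ (A :+ κ 3) :+ p :=
          A :* A :+ κ 4 :* A :+ κ 11 :- p :* p) refl A p))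

      e₂<2″ : A - k 1 < e₁ → A + k 4 < (k 1 + p) * ((k 1 + p) * e₃) → e₂ < k 2
      e₂<2″ <e₁ <τ = e₂<2 <e₁ <τ
        (trans (solve 4 (λ p e₁ e₂ e₃ → e₂ :* (e₁ :* ((κ 1 :+ p) :* ((κ 1 :+ p) :* e₃))) :=
            (κ 1 :+ p) :* (κ 1 :+ p) :* (e₁ :* (e₂ :* e₃))) refl p e₁ e₂ e₃)
            (product (k 1 + p) (k 1 + p)))
        (<-by (pos-+ (x<y⇒0<y-x p[1+p]<) (x<y⇒0<y-x p<A+2)) (solve 2 (λ A p →
          A :* A :+ κ 3 :* A :+ κ 8 :- p :* (κ 1 :+ p) :+ (A :+ κ 2 :- p) :=
          A :* A :+ κ 4 :* A :+ κ 11 :- (κ 1 :+ p) :* (κ 1 :+ p)) refl A p))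

      energy₁ : e₁ < A → (k 1 + p) * e₂ < k 4 →
          energy ((q - k 1) * e₃) (- ((k 1 - s) * e₁)) (- ((k 1 + p) * e₂)) < M
      energy₁ e₁<A <4 = <-trans (energy-box-< (A + k 1) A (k 4) (pos-* 0<q-1 0<e₃) [q-1]*e₃<
        (pos-* 0<1-s 0<e₁) ([1-s]y< 0<e₁ e₁<A) (pos-* 0<1+p 0<e₂) <4)
            (A-< 99 1979 20 0 (solve 1 (λ A →
            κ 100 :* ((κ 3 :* (A :* A :+ κ 3 :* A :+ κ 9)) :-
            ((A :+ κ 1) :* (A :+ κ 1) :+ A :* A :+ κ 4 :* κ 4 :+ (A :+ κ 1) :* A :+ (A :+ κ 1) :* κ
            4)) := Q 1979 20 0 A) refl A))

      energy₂ : e₃ < A → p * e₂ < k 4 → energy (p * e₂) (- (q * e₃)) (- (s * e₁)) < M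
      energy₂ e₃<A <4 = <-trans (energy-box-< (k 4) (A + k 1) (A + k 2) (pos-* 0<p 0<e₂) <4
        (pos-* 0<q 0<e₃) (q*e₃< e₃<A) (pos-* 0<s 0<e₁) s*e₁<)
            (A-< 99 710 88 1 (solve 1 (λ A → κ 100 :*
            ((κ 3 :* (A :* A :+ κ 3 :* A :+ κ 9)) :-
            (κ 4 :* κ 4 :+ (A :+ κ 1) :* (A :+ κ 1) :+ (A :+ κ 2) :* (A :+ κ 2) :+ κ 4 :* (A :+ κ 1)
            :+ κ 4 :* (A :+ κ 2))) := Q 710 88 1 A) refl A))

      energy₃ : A - k 1 < e₃ → k 3 < (k 1 + p) * e₂ → A + k 4 < p * (p * e₁) →
        energy (p * e₁) (- (q * e₂)) (- (s * e₃)) < M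
      energy₃ <e₃ 3< <τ = <-trans (energy-box-< (A - k 1) (k 4) (A + k 1) (pos-* 0<p 0<e₁)
          (p*e₁< <e₃ 3<)
        (pos-* 0<q 0<e₂) (<-resp refl (solve 0 (κ 2 :* κ 2 := κ 4) refl)
            (<-* 0<q q<2 0<e₂ (e₂<2′ <e₃ <τ)))
        (pos-* 0<s 0<e₃) s*e₃<) (A-< 99 4849 50 0
            (solve 1 (λ A → κ 100 :* ((κ 3 :* (A :* A :+ κ 3 :* A :+ κ 9)) :-
            ((A :- κ 1) :* (A :- κ 1) :+ κ 4 :* κ 4 :+ (A :+ κ 1) :* (A :+ κ 1) :+ (A :- κ 1) :* κ 4
            :+ (A :- κ 1) :* (A :+ κ 1))) := Q 4849 50 0 A) refl A))
        where
        q<2 : q < k 2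
        q<2 = <-by (pos-+ (x<y⇒0<y-x 7[q-1]<1) (pos-* (pos-ι 5) 0<q-1))
          (solve 1 (λ q → (κ 1 :- (q :- κ 1) :* κ 7) :+ κ 6 :* (q :- κ 1) := κ 2 :- q) refl q)

      energy₄ : A - k 1 < e₁ → k 3 < p * e₂ → A + k 4 < (k 1 + p) * ((k 1 + p) * e₃) →
        energy ((q - k 1) * e₁) (- ((k 1 - s) * e₂)) (- ((k 1 + p) * e₃)) < M
      energy₄ <e₁ 3< <τ = <-trans (energy-box-< (A + k 4) (k 2) (A - k 2) (pos-* 0<q-1 0<e₁)
          [q-1]*e₁<
        (pos-* 0<1-s 0<e₂) ([1-s]y< 0<e₂ (e₂<2″ <e₁ <τ)) (pos-* 0<1+p 0<e₃) ([1+p]*e₃< <e₁ 3<))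
            (A-< 99 989 10 0 (solve 1 (λ A → κ 100 :*
            ((κ 3 :* (A :* A :+ κ 3 :* A :+ κ 9)) :-
            ((A :+ κ 4) :* (A :+ κ 4) :+ κ 2 :* κ 2 :+ (A :- κ 2) :* (A :- κ 2) :+ (A :+ κ 4) :* κ 2
            :+ (A :+ κ 4) :* (A :- κ 2))) := Q 989 10 0 A) refl A))

      [A+8]²<M : (A + k 8) * (A + k 8) < M
      [A+8]²<M = (A-< 99 991 206 2
          (solve 1 (λ A → κ 100 :* ((κ 3 :* (A :* A :+ κ 3 :* A :+ κ 9)) :-
          ((A :+ κ 8) :* (A :+ κ 8))) := Q 991 206 2 A) refl A))

      A<A+8 : A < A + k 8
      A<A+8 = <-by (pos-ι 7) (solve 1 (λ A → κ 8 := A :+ κ 8 :- A) refl A)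

      e₂<A+8 : e₂ < A + k 8
      e₂<A+8 = <-trans e₂< (A-< 99 389 10 0 (solve 1
          (λ A → κ 100 :* ((A :+ κ 8) :- (κ 11)) := Q 389 10 0 A) refl A))

      energy₅ : e₁ < A → e₃ < A → energy e₁ e₂ e₃ < M
      energy₅ e₁<A e₃<A = <-trans (energy-pos-< (A + k 8) (0<A+ 8) 0<e₁ (<-trans e₁<A A<A+8)
        0<e₂ e₂<A+8 0<e₃ (<-trans e₃<A A<A+8)) [A+8]²<M

      s*[s*e₃]<1 : s * (s * e₃) < k 1
      s*[s*e₃]<1 = <-trans (<-*ˡ 0<s s*e₃<) s[A+1]<1

      energy₆ : p * (p * e₁) < A + k 5 → energy (p * (p * e₁)) (q * (q * e₂)) (s * (s * e₃)) < M
      energy₆ <τ = <-trans (energy-pos-< (A + k 8) (0<A+ 8)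
        (pos-* 0<p (pos-* 0<p 0<e₁)) (<-trans <τ
            (<-by (pos-ι 2) (solve 1 (λ A → κ 3 := A :+ κ 8 :- (A :+ κ 5)) refl A)))
        (pos-* 0<q (pos-* 0<q 0<e₂)) qqe₂<
        (pos-* 0<s (pos-* 0<s 0<e₃)) (<-trans s*[s*e₃]<1
            (A-< 99 1389 10 0 (solve 1 (λ A → κ 100 :* ((A :+ κ 8) :- (κ 1)) := Q 1389 10 0 A) refl
            A)))) [A+8]²<M
        where
        7q<8 : k 7 * q < k 8
        7q<8 = <-by (x<y⇒0<y-x 7[q-1]<1) (solve 1
            (λ q → κ 1 :- (q :- κ 1) :* κ 7 := κ 8 :- κ 7 :* q) refl q)
        0<7q = pos-* (pos-ι 6) 0<q
        qqe₂< : q * (q * e₂) < A + k 8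
        qqe₂< = <-cancelˡ (pos-ι 48) (<-trans
          (<-resp (solve 2 (λ q e → κ 7 :* q :* (κ 7 :* q :* e) := κ 49 :* (q :* (q :* e))) refl q
              e₂) refl
            (<-* 0<7q 7q<8 (pos-* 0<7q 0<e₂) (<-* 0<7q 7q<8 0<e₂ e₂<)))
          (A-< 99 2609 490 0 (solve 1 (λ A → κ 100 :*
              ((κ 49 :* (A :+ κ 8)) :- (κ 8 :* (κ 8 :* κ 11))) := Q 2609 490 0 A) refl A)))

      energy₇ : (k 1 + p) * ((k 1 + p) * e₃) < A + k 5 →
        energy ((q - k 1) * ((q - k 1) * e₁)) ((k 1 - s) * ((k 1 - s) * e₂))
            ((k 1 + p) * ((k 1 + p) * e₃)) < M
      energy₇ <τ = <-trans (energy-pos-< (A + k 8) (0<A+ 8)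
        (pos-* 0<q-1 (pos-* 0<q-1 0<e₁)) (<-trans (<-*ˡ 0<q-1 [q-1]*e₁<)
          (<-by (pos-+ (pos-+ (x<y⇒0<y-x [q-1][A+1]<1) (x<y⇒0<y-x 7[q-1]<1))
              (pos-+ (0<A+ 6) (pos-* (pos-ι 3) 0<q-1)))
            (solve 2 (λ A q → (κ 1 :- (q :- κ 1) :* (A :+ κ 1)) :+ (κ 1 :- (q :- κ 1) :* κ 7) :+
                (A :+ κ 6 :+ κ 4 :* (q :- κ 1)) :=
              A :+ κ 8 :- (q :- κ 1) :* (A :+ κ 4)) refl A q)))
        (pos-* 0<1-s (pos-* 0<1-s 0<e₂)) ([1-s]y< (pos-* 0<1-s 0<e₂) ([1-s]y< 0<e₂ e₂<A+8))
        (pos-* 0<1+p (pos-* 0<1+p 0<e₃)) (<-trans <τ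
            (<-by (pos-ι 2) (solve 1 (λ A → κ 3 := A :+ κ 8 :- (A :+ κ 5)) refl A)))) [A+8]²<M

      s[1-s]e₁< : s * ((k 1 - s) * e₁) < A + k 1
      s[1-s]e₁< = <-cancelˡ (pos-* 0<1+p 0<1+p) (<-resp (sym eq) refl (<-trans (<-*ˡ 0<p e₁<) lt))
        where
        eq : (k 1 + p) * (k 1 + p) * (s * ((k 1 - s) * e₁)) ≈ p * e₁
        eq = ≈-by ((s * (k 1 + p) + k 1) * p * e₁) (x≈y⇒x-y≈0 s[1+p])
          (≈-by (- ((k 1 + p) * (k 1 + p) * s * e₁)) (x≈y⇒x-y≈0 ps) (solve 3 (λ p s e →
            (κ 1 :+ p) :* (κ 1 :+ p) :* (s :* ((κ 1 :- s) :* e)) := p :* e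
            :+ (s :* (κ 1 :+ p) :+ κ 1) :* p :* e :* (s :* (κ 1 :+ p) :- κ 1)
            :+ :- ((κ 1 :+ p) :* (κ 1 :+ p) :* s :* e) :* (p :* s :- (κ 1 :- s))) refl p s e₁))
        0<d = x<y⇒0<y-x A+1<p
        lt : p * ((A + k 2) * (A + k 2)) < (k 1 + p) * (k 1 + p) * (A + k 1)
        lt = <-by (pos-* 0<d (pos-+ (pos-* (0<A+ 0) (0<A+ 2)) (pos-* (0<A+ 1) 0<d)))
          (solve 2 (λ A p → let d = p :- (A :+ κ 1) in
              d :* ((A :+ κ 0) :* (A :+ κ 2) :+ (A :+ κ 1) :* d) :=
            (κ 1 :+ p) :* (κ 1 :+ p) :* (A :+ κ 1) :- p :* ((A :+ κ 2) :* (A :+ κ 2))) refl A p)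

      q[q-1]e₃< : q * ((q - k 1) * e₃) < A + k 2
      q[q-1]e₃< = <-cancelˡ (pos-* 0<p 0<p) (<-resp (sym eq) refl (<-trans (<-*ˡ 0<1+p e₃<) lt))
        where
        eq : p * p * (q * ((q - k 1) * e₃)) ≈ (k 1 + p) * e₃
        eq = ≈-by (p * q * e₃) (x≈y⇒x-y≈0 [q-1]p) (≈-by e₃ (x≈y⇒x-y≈0 pq) (solve 3 (λ p q e →
            p :* p :* (q :* ((q :- κ 1) :* e)) := (κ 1 :+ p) :* e
              :+ p :* q :* e :* ((q :- κ 1) :* p :- κ 1) :+ e :* (p :* q :- (κ 1 :+ p))) refl p q
                  e₃))
        0<d = x<y⇒0<y-x A+1<p
        lt : (k 1 + p) * ((A + k 1) * (A + k 1)) < p * p * (A + k 2)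
        lt = <-by (pos-* 0<d (pos-+ (pos-* (0<A+ 2) 0<p) (0<A+ 1)))
          (solve 2 (λ A p → let d = p :- (A :+ κ 1) in d :* ((A :+ κ 2) :* p :+ (A :+ κ 1)) :=
            p :* p :* (A :+ κ 2) :- (κ 1 :+ p) :* ((A :+ κ 1) :* (A :+ κ 1))) refl A p)

      p[1+p]e₂< : A - k 1 < e₁ → A - k 1 < e₃ → p * ((k 1 + p) * e₂) < k 3
      p[1+p]e₂< <e₁ <e₃ = <-cancelˡ (pos-* 0<A-1 0<A-1) (<-trans
        (<-resp (*-comm (p * ((k 1 + p) * e₂)) ((A - k 1) * (A - k 1)))
          (trans (solve 4 (λ p e₁ e₂ e₃ → p :* ((κ 1 :+ p) :* e₂) :* (e₁ :* e₃) :=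
              p :* (κ 1 :+ p) :* (e₁ :* (e₂ :* e₃))) refl p e₁ e₂ e₃)
            (product p (k 1 + p)))
          (<-*ˡ (pos-* 0<p (pos-* 0<1+p 0<e₂)) (<-* 0<A-1 <e₁ 0<A-1 <e₃)))
        (<-trans p[1+p]< (A-< 99 2811 186 2 (solve 1
            (λ A → κ 100 :* (((A :- κ 1) :* (A :- κ 1) :* κ 3) :- (A :* A :+ κ 3 :* A :+ κ 8)) :=
            Q 2811 186 2 A) refl A))))

      energy₈ : A - k 1 < e₁ → A - k 1 < e₃ →
        energy (s * ((k 1 - s) * e₁)) (- (p * ((k 1 + p) * e₂))) (- (q * ((q - k 1) * e₃))) < M
      energy₈ <e₁ <e₃ = bound (pos-* 0<s (pos-* 0<1-s 0<e₁)) s[1-s]e₁<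
          (pos-* 0<p (pos-* 0<1+p 0<e₂)) (p[1+p]e₂< <e₁ <e₃)
          (pos-* 0<q (pos-* 0<q-1 0<e₃)) q[q-1]e₃<
        where
        bound : ∀ {u v w} → 0< u → u < A + k 1 → 0< v → v < k 3 → 0< w → w < A + k 2 →
            energy u (- v) (- w) < M
        bound {u} {v} {w} 0<u u< 0<v v< 0<w w< = <-by
          (pos-+ (pos-+ (pos-+
            (pos-* (x<y⇒0<y-x w<) (pos-+ (pos-+ (pos-+ (x<y⇒0<y-x v<) 0<A-1) 0<w) 0<u))
            (pos-* (x<y⇒0<y-x u<) (pos-+ (pos-+ (pos-+ (0<A+ 1) 0<u) 0<v) (0<A+ 2))))
            (pos-* (x<y⇒0<y-x v<) (pos-+ 0<v (pos-ι 1)))) (pos-ι 13))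
          (solve 4 (λ A u v w →
            (A :+ κ 2 :- w) :* (κ 3 :- v :+ (A :- κ 1) :+ w :+ u) :+ (A :+ κ 1 :- u) :*
                (A :+ κ 1 :+ u :+ v :+ (A :+ κ 2))
            :+ (κ 3 :- v) :* (v :+ κ 2) :+ κ 14 :=
            κ 3 :* (A :* A :+ κ 3 :* A :+ κ 9) :-
            (u :* u :+ :- v :* :- v :+ :- w :* :- w :- (u :* :- v :+ :- v :* :- w :+ :- w :* u)))
                refl A u v w)

  module Main (a : ℤ) (7≤a : + 7 ℤ.≤ a) where
    private A = ι a
    open Order a
    open Anisotropic a
    open Small a 7≤a
    open Embedding a

    cubic-expand : ∀ x → eval (Defs.cubic a) x ≈ x * x * x - A * (x * x) - (A + k 3) * x - k 1
    cubic-expand x = trans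
      (+-congˡ (*-congˡ (+-cong (trans (ι-neg (a ℤ.+ + 3)) (-‿cong (ι-+ a (+ 3))))
          (*-congˡ (+-congʳ (ι-neg a))))))
      (solve 2 (λ A x → con -[1+ 0 ] :+ x :* (:- (A :+ κ 3) :+ x :*
          (:- A :+ x :* (κ 1 :+ x :* κ 0))) :=
        x :* x :* x :- A :* (x :* x) :- (A :+ κ 3) :* x :- κ 1) refl A x)

    module Vieta {r r′ r″ : Carrier}
      (fr : eval (Defs.cubic a) r ≈ k 0) (fr′ : eval (Defs.cubic a) r′ ≈ k 0)
          (fr″ : eval (Defs.cubic a) r″ ≈ k 0)
      (0<r : 0< r) (r′<-1 : r′ < ι -[1+ 0 ]) (-1<r″ : ι -[1+ 0 ] < r″) (r″<0 : r″ < k 0) where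

      f D : Carrier → Carrier
      f x = x * x * x - A * (x * x) - (A + k 3) * x - k 1
      D y = r * r + r * y + y * y - A * (r + y) - (A + k 3)
      g : Carrier
      g = A + k 2 + A * r - r * r

      f≈0 : ∀ {x} → eval (Defs.cubic a) x ≈ k 0 → f x ≈ k 0
      f≈0 {x} eq = trans (sym (cubic-expand x)) eq

      r″<r : r″ < r
      r″<r = <-trans r″<0 0<r

      r′<r″ : r′ < r″
      r′<r″ = <-trans r′<-1 -1<r″

      D≈0 : ∀ {y} → f y ≈ k 0 → y < r → D y ≈ k 0
      D≈0 {y} fy y<r = cancel-≈0 (x<y⇒0<y-x y<r) (≈-by (k 1) (f≈0 fr) (≈-by (- k 1) fy
        (solve 3 (λ A r y →
          (r :- y) :* (r :* r :+ r :* y :+ y :* y :- A :* (r :+ y) :- (A :+ κ 3)) :=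
          κ 0 :+ κ 1 :* (r :* r :* r :- A :* (r :* r) :- (A :+ κ 3) :* r :- κ 1)
          :+ :- κ 1 :* (y :* y :* y :- A :* (y :* y) :- (A :+ κ 3) :* y :- κ 1)) refl A r y)))

      sum≈0 : r + r′ + r″ - A ≈ k 0
      sum≈0 = cancel-≈0 (x<y⇒0<y-x r′<r″)
        (≈-by (k 1) (D≈0 (f≈0 fr″) r″<r) (≈-by (- k 1) (D≈0 (f≈0 fr′) (<-trans r′<r″ r″<r))
        (solve 4 (λ A r r′ r″ →
            let D = λ y → r :* r :+ r :* y :+ y :* y :- A :* (r :+ y) :- (A :+ κ 3) in
          (r″ :- r′) :* (r :+ r′ :+ r″ :- A) := κ 0 :+ κ 1 :* D r″ :+ :- κ 1 :* D r′) refl A r r′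
              r″)))

      -1-g>0 : 0< ι -[1+ 0 ] - g
      -1-g>0 = pos-cancel 0<r (<-resp refl (sym (≈-by (k 1) (f≈0 fr) (solve 2 (λ A r →
        r :* (con -[1+ 0 ] :- (A :+ κ 2 :+ A :* r :- r :* r)) :=
        κ 1 :+ κ 1 :* (r :* r :* r :- A :* (r :* r) :- (A :+ κ 3) :* r :- κ 1)) refl A r)))
            (pos-ι 0))

      g<r″ : g < r″
      g<r″ = <-by (pos-+ (x<y⇒0<y-x -1<r″) -1-g>0)
        (solve 2 (λ g r″ → (r″ :- con -[1+ 0 ]) :+ (con -[1+ 0 ] :- g) := r″ :- g) refl g r″)

      r′≈g : r′ ≈ g
      r′≈g = x-y≈0⇒x≈y (cancel-≈0 (x<y⇒0<y-x g<r″)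
        (≈-by (r′ - g) sum≈0 (≈-by (- k 1) (D≈0 (f≈0 fr′) (<-trans r′<r″ r″<r))
            (≈-by (- (k 1 + A - r)) (f≈0 fr)
        (solve 4 (λ A r r′ r″ → let g = A :+ κ 2 :+ A :* r :- r :* r in
          (r″ :- g) :* (r′ :- g) := κ 0 :+ (r′ :- g) :* (r :+ r′ :+ r″ :- A)
          :+ :- κ 1 :* (r :* r :+ r :* r′ :+ r′ :* r′ :- A :* (r :+ r′) :- (A :+ κ 3))
          :+ :- (κ 1 :+ A :- r) :* (r :* r :* r :- A :* (r :* r) :- (A :+ κ 3) :* r :- κ 1)) refl A
              r r′ r″)))))

      r″≈ : r″ ≈ A - r - g
      r″≈ = ≈-by (k 1) sum≈0 (≈-by (- k 1) (x≈y⇒x-y≈0 r′≈g) (solve 5 (λ A g r r′ r″ →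
        r″ := A :- r :- g :+ κ 1 :* (r :+ r′ :+ r″ :- A) :+ :- κ 1 :* (r′ :- g)) refl A g r r′ r″))

      cyclic : Cyclic r r′ r″
      cyclic = record
        { r+r′+r″ = x-y≈0⇒x≈y sum≈0
        ; rr′ = trans (*-congˡ r′≈g) (≈-by (- k 1) (f≈0 fr) (solve 2 (λ A r →
            r :* (A :+ κ 2 :+ A :* r :- r :* r) :=
                :- κ 1 :- r :+ :- κ 1 :* (r :* r :* r :- A :* (r :* r) :- (A :+ κ 3) :* r :- κ 1))
                refl A r))
        ; r′r″ = trans (*-cong r′≈g r″≈) (trans
            (≈-by (k 1 + A - r) (f≈0 fr) (solve 2 (λ A r → let g = A :+ κ 2 :+ A :* r :- r :* r in
            g :* (A :- r :- g) := :- κ 1 :- g :+ (κ 1 :+ A :- r) :*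
                (r :* r :* r :- A :* (r :* r) :- (A :+ κ 3) :* r :- κ 1)) refl A r))
            (+-congˡ (-‿cong (sym r′≈g))))
        ; r″r = trans (*-congʳ r″≈)
            (trans (≈-by (k 1) (f≈0 fr) (solve 2 (λ A r → let g = A :+ κ 2 :+ A :* r :- r :* r in
            (A :- r :- g) :* r := :- κ 1 :- (A :- r :- g) :+ κ 1 :*
                (r :* r :* r :- A :* (r :* r) :- (A :+ κ 3) :* r :- κ 1)) refl A r))
            (+-congˡ (-‿cong (sym r″≈))))
        }

    module Units {r r′ r″ : Carrier} (C : Cyclic r r′ r″) (A+1<r : A + k 1 < r) (r″<0 : r″ < k 0)
        where
      open Cyclic C

      p = r
      q = - r′
      s = - r″

      location : Location A p q s
      location = record
        { 69<10A = <-resp refl (trans (ι-+ (+ 10 ℤ.* a) (ℤ.- + 69))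
            (+-cong (ι-* (+ 10) a) (ι-neg (+ 69))))
            (ι-mono-< (ℤ.<-≤-trans (ℤ.+<+ (s≤s z≤n))
                (ℤ.+-monoˡ-≤ (ℤ.- + 69) (ℤ.*-monoˡ-≤-nonNeg (+ 10) 7≤a))))
        ; A+1<p = A+1<r
        ; 0<s = <-by (x<y⇒0<y-x r″<0) (solve 1 (λ r″ → κ 0 :- r″ := :- r″ :- κ 0) refl r″)
        ; pq = trans (solve 2 (λ r r′ → r :* :- r′ := :- (r :* r′)) refl r r′)
            (trans (-‿cong rr′) (solve 1 (λ r → :- (:- κ 1 :- r) := κ 1 :+ r) refl r))
        ; qs = trans (solve 2 (λ r′ r″ → :- r′ :* :- r″ := r′ :* r″) refl r′ r″)
            (trans r′r″ (solve 1 (λ r′ → :- κ 1 :- r′ := :- r′ :- κ 1) refl r′))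
        ; ps = trans (solve 2 (λ r r″ → r :* :- r″ := :- (r″ :* r)) refl r r″)
            (trans (-‿cong r″r) (solve 1 (λ r → :- (:- κ 1 :- r) := κ 1 :- :- r) refl r″))
        ; p≈A+q+s = ≈-by (k 1) (x≈y⇒x-y≈0 r+r′+r″) (solve 4 (λ A r r′ r″ →
            r := A :+ :- r′ :+ :- r″ :+ κ 1 :* (r :+ r′ :+ r″ :- A)) refl A r r′ r″)
        }

      open Estimates location public

      record Conjugates (α : Triple ℤ) (x y z : Carrier) : Set where
        constructor conjugates
        field
          φ₁ : φ r r′ α ≈ x
          φ₂ : φ r′ r″ α ≈ y
          φ₃ : φ r″ r α ≈ z
      open Conjugates

      conj-· : ∀ {α β x y z x′ y′ z′} → Conjugates α x y z → Conjugates β x′ y′ z′ →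
          Conjugates (α · β) (x * x′) (y * y′) (z * z′)
      conj-· {α} {β} c c′ = conjugates
        (trans (φ-· C α β) (*-cong (φ₁ c) (φ₁ c′)))
        (trans (φ-· (rotate C) α β) (*-cong (φ₂ c) (φ₂ c′)))
        (trans (φ-· (rotate (rotate C)) α β) (*-cong (φ₃ c) (φ₃ c′)))

      conj-σ : ∀ {α x y z} → Conjugates α x y z → Conjugates (σ α) y z x
      conj-σ {α} c = conjugates (trans (φ-σ C α) (φ₂ c)) (trans (φ-σ (rotate C) α) (φ₃ c))
          (trans (φ-σ (rotate (rotate C)) α) (φ₁ c))

      norm≈ : ∀ {α x y z} → Conjugates α x y z → ι (norm α) ≈ x * (y * z)
      norm≈ {α} c = trans (sym (φ-constant C (norm α)))
          (trans (reflexive (≡.cong (φ r r′) (≡.sym (·-norm α))))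
        (φ₁ (conj-· c (conj-· (conj-σ c) (conj-σ (conj-σ c))))))

      energy≈ : ∀ {α x y z} → Conjugates α x y z → energy x y z ≈ ι (conductor ℤ.* h α)
      energy≈ {α} {x} {y} {z} c = trans (+-congʳ squares)
        (solve 2 (λ u v → u :+ v :- v := u) refl (ι (conductor ℤ.* h α)) (x * y + y * z + z * x))
        where
        c′ = conj-σ c
        c″ = conj-σ c′
        squares : x * x + y * y + z * z ≈ ι (conductor ℤ.* h α) + (x * y + y * z + z * x)
        squares = trans (sym (trans (φ-∔ C (α · α ∔ σ α · σ α) _) (+-cong (trans (φ-∔ C (α · α) _)
              (+-cong (φ₁ (conj-· c c)) (φ₁ (conj-· c′ c′)))) (φ₁ (conj-· c″ c″)))))
          (trans (reflexive (≡.cong (φ r r′) (·-h α)))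
            (trans (φ-∔ C (constant (conductor ℤ.* h α)) _)
                (+-cong (φ-constant C (conductor ℤ.* h α))
              (trans (φ-∔ C (α · σ α ∔ σ α · σ (σ α)) _) (+-cong (trans (φ-∔ C (α · σ α) _)
                (+-cong (φ₁ (conj-· c c′)) (φ₁ (conj-· c′ c″)))) (φ₁ (conj-· c″ c)))))))

      record Unit (α : Triple ℤ) (x y z : Carrier) : Set where
        constructor unit
        field
          conj   : Conjugates α x y z
          norm≡1 : norm α ≡ + 1
      open Unit

      xyz≈1 : ∀ {α x y z} → Unit α x y z → x * (y * z) ≈ k 1
      xyz≈1 (unit c N) = trans (sym (norm≈ c)) (reflexive (≡.cong ι N))

      xyz≈1⇒unit : ∀ {α x y z} → Conjugates α x y z → x * (y * z) ≈ k 1 → Unit α x y z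
      xyz≈1⇒unit c eq = unit c (ι-injective (trans (norm≈ c) eq))

      unit-· : ∀ {α β x y z x′ y′ z′} → Unit α x y z → Unit β x′ y′ z′ →
          Unit (α · β) (x * x′) (y * y′) (z * z′)
      unit-· {x = x} {y} {z} {x′} {y′} {z′} u v = xyz≈1⇒unit (conj-· (conj u) (conj v))
        (trans (solve 6 (λ x y z x′ y′ z′ → x :* x′ :* (y :* y′ :* (z :* z′)) :=
            x :* (y :* z) :* (x′ :* (y′ :* z′))) refl x y z x′ y′ z′)
          (trans (*-cong (xyz≈1 u) (xyz≈1 v)) (solve 0 (κ 1 :* κ 1 := κ 1) refl)))

      unit-σ : ∀ {α x y z} → Unit α x y z → Unit (σ α) y z x
      unit-σ {x = x} {y} {z} u = xyz≈1⇒unit (conj-σ (conj u))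
        (trans (solve 3 (λ x y z → y :* (z :* x) := x :* (y :* z)) refl x y z) (xyz≈1 u))

      unit-≈ : ∀ {α x y z x′ y′ z′} → x ≈ x′ → y ≈ y′ → z ≈ z′ → Unit α x y z → Unit α x′ y′ z′
      unit-≈ x≈ y≈ z≈ (unit (conjugates c₁ c₂ c₃) N) =
          unit (conjugates (trans c₁ x≈) (trans c₂ y≈) (trans c₃ z≈)) N

      ρ̂ ρ̂⁻¹ : Triple ℤ
      ρ̂   = ⟨ + 0 , + 1 , + 0 ⟩
      ρ̂⁻¹ = ⟨ -[1+ 0 ] , + 0 , -[1+ 0 ] ⟩

      private
        φρ̂ : ∀ x y → φ x y ρ̂ ≈ x
        φρ̂ = solve 2 (λ x y → κ 0 :+ κ 1 :* x :+ κ 0 :* y := x) refl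

        φρ̂⁻¹ : ∀ x y → φ x y ρ̂⁻¹ ≈ - k 1 - y
        φρ̂⁻¹ = solve 2 (λ x y → con -[1+ 0 ] :+ κ 0 :* x :+ con -[1+ 0 ] :* y := :- κ 1 :- y) refl

      ρ-unit : Unit ρ̂ p (- q) (- s)
      ρ-unit = xyz≈1⇒unit (conjugates (φρ̂ r r′)
          (trans (φρ̂ r′ r″) (solve 1 (λ x → x := :- :- x) refl r′))
              (trans (φρ̂ r″ r) (solve 1 (λ x → x := :- :- x) refl r″)))
        (trans (solve 3 (λ r r′ r″ → r :* (:- :- r′ :* :- :- r″) := r :* (r′ :* r″)) refl r r′ r″)
          (trans (*-congˡ r′r″) (≈-by (- k 1) (x≈y⇒x-y≈0 rr′)
            (solve 2 (λ r r′ → r :* (:- κ 1 :- r′) := κ 1 :+ :- κ 1 :* (r :* r′ :- (:- κ 1 :- r)))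
                refl r r′))))

      ρ⁻¹-unit : Unit ρ̂⁻¹ (q - k 1) (- (k 1 - s)) (- (k 1 + p))
      ρ⁻¹-unit = xyz≈1⇒unit (conjugates
          (trans (φρ̂⁻¹ r r′) (solve 1 (λ x → :- κ 1 :- x := :- x :- κ 1) refl r′))
          (trans (φρ̂⁻¹ r′ r″) (solve 1 (λ x → :- κ 1 :- x := :- (κ 1 :- :- x)) refl r″))
          (trans (φρ̂⁻¹ r″ r) (solve 1 (λ x → :- κ 1 :- x := :- (κ 1 :+ x)) refl r)))
        (≈-by (k 1) (x≈y⇒x-y≈0 [q-1]p) (≈-by (- (q - k 1)) (x≈y⇒x-y≈0 s[1+p])
          (solve 3 (λ p q s → (q :- κ 1) :* (:- (κ 1 :- s) :* :- (κ 1 :+ p)) :=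
            κ 1 :+ κ 1 :* ((q :- κ 1) :* p :- κ 1) :+ :- (q :- κ 1) :* (s :* (κ 1 :+ p) :- κ 1))
                refl p q s)))

      data Kind (x y z : Carrier) : Set where
        one : x ≈ k 1 → y ≈ k 1 → z ≈ k 1 → Kind x y z
        rho : x ≈ p → y ≈ - q → z ≈ - s → Kind x y z
        inv : x ≈ q - k 1 → y ≈ - (k 1 - s) → z ≈ - (k 1 + p) → Kind x y z

      h<3 : ∀ {α x y z} → Conjugates α x y z → energy x y z < M → h α ℤ.< + 3
      h<3 {α} c lt = ι-cancel-< (<-cancelˡ 0<m (<-resp
        (trans (energy≈ c) (trans (ι-* conductor (h α)) (*-congʳ m≈))) (*-comm (k 3) m) lt))
        where
        m = A * A + k 3 * A + k 9
        m≈ : ι conductor ≈ m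
        m≈ = trans (ι-+ (a ℤ.* a ℤ.+ + 3 ℤ.* a) (+ 9))
            (+-congʳ (trans (ι-+ (a ℤ.* a) (+ 3 ℤ.* a)) (+-cong (ι-* a a) (ι-* (+ 3) a))))
        0<m : 0< m
        0<m = <-resp refl (solve 1 (λ A → (A :+ κ 0) :* (A :+ κ 0) :+ κ 3 :* (A :+ κ 0) :+ κ 9 :=
            A :* A :+ κ 3 :* A :+ κ 9) refl A)
          (pos-+ (pos-+ (pos-* (0<A+ 0) (0<A+ 0)) (pos-* (pos-ι 2) (0<A+ 0))) (pos-ι 8))

      pos≉neg : ∀ {x y} → 0< x → 0< y → ¬ x ≈ - y
      pos≉neg {x} {y} 0<x 0<y eq = 0<⇒≉0 (pos-+ 0<x 0<y)
          (trans (+-congʳ eq) (solve 1 (λ y → :- y :+ y := κ 0) refl y))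

      classify : ∀ {α x y z} → Unit α x y z → 0< x → energy x y z < M → Kind x y z
      classify {α} {x} {y} {z} (unit c N≡1) 0<x lt = kind (neighbours α N≡1 (h<3 c lt)) c
        where
        via : ∀ {β x′ y′ z′} → Conjugates β x y z → Conjugates β x′ y′ z′ →
            (x ≈ x′ → y ≈ y′ → z ≈ z′ → Kind x y z) → Kind x y z
        via c c′ f = f (trans (sym (φ₁ c)) (φ₁ c′)) (trans (sym (φ₂ c)) (φ₂ c′))
            (trans (sym (φ₃ c)) (φ₃ c′))
        kind : ∀ {β} → Neighbour β → Conjugates β x y z → Kind x y z
        kind isOne c = via c (conjugates (φ-constant C (+ 1)) (φ-constant (rotate C) (+ 1))
            (φ-constant (rotate (rotate C)) (+ 1))) one
        kind isρ   c = via c (conj ρ-unit) rho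
        kind is1/ρ c = via c (conj ρ⁻¹-unit) inv
        kind isρ′  c = ⊥-elim (pos≉neg 0<x 0<q (trans (sym (φ₁ c))
          (solve 2 (λ r r′ → κ 0 :+ κ 0 :* r :+ κ 1 :* r′ := :- :- r′) refl r r′)))
        kind isρ″  c = ⊥-elim (pos≉neg 0<x 0<s (trans (sym (φ₁ c)) (≈-by (- k 1) (x≈y⇒x-y≈0 r+r′+r″)
          (solve 4 (λ A r r′ r″ → A :+ con -[1+ 0 ] :* r :+ con -[1+ 0 ] :* r′ :=
              :- :- r″ :+ :- κ 1 :* (r :+ r′ :+ r″ :- A)) refl A r r′ r″))))
        kind is1/ρ′ c = ⊥-elim (pos≉neg 0<x 0<1-s
            (trans (sym (φ₁ c)) (trans (+-congʳ
            (+-congʳ (trans (ι-+ -[1+ 0 ] (ℤ.- a)) (+-congˡ (ι-neg a)))))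
          (≈-by (k 1) (x≈y⇒x-y≈0 r+r′+r″)
          (solve 4 (λ A r r′ r″ → con -[1+ 0 ] :- A :+ κ 1 :* r :+ κ 1 :* r′ :=
              :- (κ 1 :- :- r″) :+ κ 1 :* (r :+ r′ :+ r″ :- A)) refl A r r′ r″)))))
        kind is1/ρ″ c = ⊥-elim (pos≉neg 0<x 0<1+p (trans (sym (φ₁ c))
          (solve 2 (λ r r′ → con -[1+ 0 ] :+ con -[1+ 0 ] :* r :+ κ 0 :* r′ := :- (κ 1 :+ r)) refl r
              r′)))

      classify-pos : ∀ {α x y z} → Unit α x y z → 0< x → 0< y → energy x y z < M → x ≈ k 1 × z ≈ k 1
      classify-pos u 0<x 0<y lt = go (classify u 0<x lt)
        where
        go : ∀ {x z} → Kind x _ z → x ≈ k 1 × z ≈ k 1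
        go (one x _ z) = x , z
        go (rho _ y _) = ⊥-elim (pos≉neg 0<y 0<q y)
        go (inv _ y _) = ⊥-elim (pos≉neg 0<y 0<1-s y)

      classify-mixed : ∀ {α x y z} → Unit α x (- y) (- z) → 0< x → 0< y → energy x (- y) (- z) < M →
        (x ≈ p × z ≈ s) ⊎ (x ≈ q - k 1 × y ≈ k 1 - s × z ≈ k 1 + p)
      classify-mixed {y = y} u 0<x 0<y lt = go (classify u 0<x lt)
        where
        neg-injective : ∀ {x y} → - x ≈ - y → x ≈ y
        neg-injective {x} {y} eq = trans (solve 1 (λ x → x := :- :- x) refl x)
            (trans (-‿cong eq) (solve 1 (λ x → :- :- x := x) refl y))
        go : ∀ {x z} → Kind x (- y) (- z) → (x ≈ p × z ≈ s) ⊎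
            (x ≈ q - k 1 × y ≈ k 1 - s × z ≈ k 1 + p)
        go (one _ y _) = ⊥-elim (pos≉neg (pos-ι 0) 0<y (sym y))
        go (rho x _ z) = inj₁ (x , neg-injective z)
        go (inv x y z) = inj₂ (x , neg-injective y , neg-injective z)

      cancel-≈ : ∀ {c x y} → 0< c → c * x ≈ c * y → x ≈ y
      cancel-≈ {c} {x} {y} 0<c eq = x-y≈0⇒x≈y (cancel-≈0 0<c
        (trans (solve 3 (λ c x y → c :* (x :- y) := c :* x :- c :* y) refl c x y) (x≈y⇒x-y≈0 eq)))

      <⇒≉ : ∀ {x y} → x < y → ¬ x ≈ y
      <⇒≉ lt eq = <-irrefl (<-resp eq refl lt)

      module _ {E : Triple ℤ} {e₁ e₂ e₃ : Carrier} (u : Unit E e₁ e₂ e₃) (0<e₁ : 0< e₁)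
          (0<e₂ : 0< e₂) (0<e₃ : 0< e₃)
        (e₁< : e₁ < (A + k 2) * (A + k 2)) (e₂< : e₂ < k 11) (e₃< : e₃ < (A + k 1) * (A + k 1))
            where
        open Bounds 0<e₁ 0<e₂ 0<e₃ (xyz≈1 u) e₁< e₂< e₃<

        Goal : Set
        Goal = e₁ ≈ k 1 ⊎ e₁ ≈ p * p

        private
          neg-*ʳ : ∀ x y → - x * y ≈ - (x * y)
          neg-*ʳ = solve 2 (λ x y → :- x :* y := :- (x :* y)) refl
          ≈*1 : ∀ x → x ≈ x * k 1
          ≈*1 = solve 1 (λ x → x := x :* κ 1) refl
          n<1+n : ∀ n → k n < k (suc n)
          n<1+n n = ι-mono-< (ℤ.+<+ ℕ.≤-refl)
          A+n<A+1+n : ∀ n → A + k n < A + k (suc n)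
          A+n<A+1+n n = +-monoʳ-< A (n<1+n n)
          A-1<A : A - k 1 < A
          A-1<A = <-by (pos-ι 0) (solve 1 (λ A → κ 1 := A :- (A :- κ 1)) refl A)

        case₁ : e₁ < A → (k 1 + p) * e₂ < k 4 → Goal
        case₁ e₁<A <4 = [ (λ (x , _) → ⊥-elim (<⇒≉ (<-trans [q-1]*e₃< A+1<r) x))
                        , (λ (_ , y , _) → inj₁ (cancel-≈ 0<1-s (trans y (≈*1 (k 1 - s))))) ]′
          (classify-mixed (unit-≈ refl (neg-*ʳ (k 1 - s) e₁) (neg-*ʳ (k 1 + p) e₂)
              (unit-· ρ⁻¹-unit (unit-σ (unit-σ u))))
            (pos-* 0<q-1 0<e₃) (pos-* 0<1-s 0<e₁) (energy₁ e₁<A <4))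

        case₂ : e₃ < A → p * e₂ < k 4 → Goal
        case₂ e₃<A <4 = [ (λ (_ , z) → inj₁ (cancel-≈ 0<s (trans z (≈*1 s))))
                        , (λ (_ , _ , z) → ⊥-elim (<⇒≉ (<-trans s*e₁< A+2<1+p) z)) ]′
          (classify-mixed (unit-≈ refl (neg-*ʳ q e₃) (neg-*ʳ s e₁) (unit-· ρ-unit (unit-σ u)))
            (pos-* 0<p 0<e₂) (pos-* 0<q 0<e₃) (energy₂ e₃<A <4))

        case₃ : A - k 1 < e₃ → k 3 < (k 1 + p) * e₂ → A + k 4 < p * (p * e₁) → Goal
        case₃ <e₃ 3< <τ = [ (λ (x , _) → inj₁ (cancel-≈ 0<p (trans x (≈*1 p))))
                          , (λ (_ , _ , z) → ⊥-elim
                              (<⇒≉ (<-trans (<-trans s*e₃< (A+n<A+1+n 1)) A+2<1+p) z)) ]′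
          (classify-mixed (unit-≈ refl (neg-*ʳ q e₂) (neg-*ʳ s e₃) (unit-· ρ-unit u))
            (pos-* 0<p 0<e₁) (pos-* 0<q 0<e₂) (energy₃ <e₃ 3< <τ))

        case₄ : A - k 1 < e₁ → k 3 < p * e₂ → A + k 4 < (k 1 + p) * ((k 1 + p) * e₃) → Goal
        case₄ <e₁ 3< <τ = [ (λ (x , _) → inj₂ (cancel-≈ 0<q-1 (trans x (sym [q-1]pp))))
                          , (λ (x , _) → inj₁ (cancel-≈ 0<q-1 (trans x (≈*1 (q - k 1))))) ]′
          (classify-mixed (unit-≈ refl (neg-*ʳ (k 1 - s) e₂) (neg-*ʳ (k 1 + p) e₃)
              (unit-· ρ⁻¹-unit u))
            (pos-* 0<q-1 0<e₁) (pos-* 0<1-s 0<e₂) (energy₄ <e₁ 3< <τ))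
          where
          [q-1]pp : (q - k 1) * (p * p) ≈ p
          [q-1]pp = ≈-by p (x≈y⇒x-y≈0 [q-1]p)
              (solve 2 (λ p q → (q :- κ 1) :* (p :* p) := p :+ p :* ((q :- κ 1) :* p :- κ 1)) refl p
              q)

        case₅ : e₁ < A → e₃ < A → Goal
        case₅ e₁<A e₃<A = inj₁ (proj₁ (classify-pos u 0<e₁ 0<e₂ (energy₅ e₁<A e₃<A)))

        case₆ : p * (p * e₁) < A + k 5 → Goal
        case₆ <τ = ⊥-elim (<⇒≉ s*[s*e₃]<1 (proj₂ (classify-pos
          (unit-≈ refl (neg² q e₂) (neg² s e₃) (unit-· ρ-unit (unit-· ρ-unit u)))
          (pos-* 0<p (pos-* 0<p 0<e₁)) (pos-* 0<q (pos-* 0<q 0<e₂)) (energy₆ <τ))))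
          where
          neg² : ∀ x y → - x * (- x * y) ≈ x * (x * y)
          neg² = solve 2 (λ x y → :- x :* (:- x :* y) := x :* (x :* y)) refl

        case₇ : (k 1 + p) * ((k 1 + p) * e₃) < A + k 5 → Goal
        case₇ <τ = inj₂ (cancel-≈ 0<q-1 (cancel-≈ 0<q-1 (trans (proj₁ (classify-pos
          (unit-≈ refl (neg² (k 1 - s) e₂) (neg² (k 1 + p) e₃)
              (unit-· ρ⁻¹-unit (unit-· ρ⁻¹-unit u)))
          (pos-* 0<q-1 (pos-* 0<q-1 0<e₁)) (pos-* 0<1-s (pos-* 0<1-s 0<e₂)) (energy₇ <τ)))
              (sym 1≈))))
          where
          neg² : ∀ x y → - x * (- x * y) ≈ x * (x * y)
          neg² = solve 2 (λ x y → :- x :* (:- x :* y) := x :* (x :* y)) refl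
          1≈ : (q - k 1) * ((q - k 1) * (p * p)) ≈ k 1
          1≈ = trans (solve 2 (λ p t → t :* (t :* (p :* p)) := (t :* p) :* (t :* p)) refl p
              (q - k 1))
            (trans (*-cong [q-1]p [q-1]p) (solve 0 (κ 1 :* κ 1 := κ 1) refl))

        case₈ : A - k 1 < e₁ → A - k 1 < e₃ → Goal
        case₈ <e₁ <e₃ = ⊥-elim ([ (λ (x , _) → <⇒≉ (<-trans s[1-s]e₁< A+1<r) x)
                                , (λ (_ , _ , z) → <⇒≉ (<-trans q[q-1]e₃< A+2<1+p) z) ]′
          (classify-mixed (unit-≈
              (solve 2 (λ s e → :- s :* (:- (κ 1 :- s) :* e) := s :* ((κ 1 :- s) :* e)) refl s e₁)
              (solve 2 (λ p e → p :* (:- (κ 1 :+ p) :* e) := :- (p :* ((κ 1 :+ p) :* e))) refl p e₂)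
              (solve 2 (λ q e → :- q :* ((q :- κ 1) :* e) := :- (q :* ((q :- κ 1) :* e))) refl q e₃)
              (unit-· (unit-σ (unit-σ ρ-unit)) (unit-· (unit-σ ρ⁻¹-unit) u)))
            (pos-* 0<s (pos-* 0<1-s 0<e₁)) (pos-* 0<p (pos-* 0<1+p 0<e₂)) (energy₈ <e₁ <e₃)))

        small-unit : Goal
        small-unit = split (<-cotrans A-1<A e₁) (<-cotrans A-1<A e₃)
          where
          split : A - k 1 < e₁ ⊎ e₁ < A → A - k 1 < e₃ ⊎ e₃ < A → Goal
          split (inj₁ <e₁) (inj₁ <e₃) = case₈ <e₁ <e₃
          split (inj₂ e₁<) (inj₂ e₃<) = case₅ e₁< e₃<
          split (inj₂ e₁<) (inj₁ <e₃) = [ (λ 3< → [ case₃ <e₃ 3< ,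
              case₆ ]′ (<-cotrans (A+n<A+1+n 4) (p * (p * e₁)))) , case₁ e₁< ]′
            (<-cotrans (n<1+n 3) ((k 1 + p) * e₂))
          split (inj₁ <e₁) (inj₂ e₃<) = [ (λ 3< → [ case₄ <e₁ 3< ,
              case₇ ]′ (<-cotrans (A+n<A+1+n 4) ((k 1 + p) * ((k 1 + p) * e₃)))) , case₂ e₃< ]′
            (<-cotrans (n<1+n 3) (p * e₂))

      conj-φ : ∀ α → Conjugates α (φ r r′ α) (φ r′ r″ α) (φ r″ r α)
      conj-φ α = conjugates refl refl refl

      private
        x*yz≈0 : ∀ {x} y z → x ≈ k 0 → x * (y * z) ≈ k 0
        x*yz≈0 y z x≈0 = trans (*-congʳ x≈0) (solve 2 (λ y z → κ 0 :* (y :* z) := κ 0) refl y z)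

      φ-faithful : ∀ α → φ r r′ α ≈ k 0 → α ≡ constant (+ 0)
      φ-faithful α eq = norm≡0⇒≡0 α (ι-injective
          (trans (norm≈ (conj-φ α)) (x*yz≈0 (φ r′ r″ α) (φ r″ r α) eq)))

      φ-determines : ∀ {α β x y z x′ y′ z′} → Conjugates α x y z → Conjugates β x′ y′ z′ → x ≈ x′ →
          y ≈ y′ × z ≈ z′
      φ-determines {α} {β} {x} {y} {z} {x′} {y′} {z′} c c′ x≈x′ =
          equal (φ₂ difference) (φ₂ vanishing) , equal (φ₃ difference) (φ₃ vanishing)
        where
        negation : Conjugates (constant -[1+ 0 ] · β) (ι -[1+ 0 ] * x′) (ι -[1+ 0 ] * y′)
            (ι -[1+ 0 ] * z′)
        negation = conj-· (conjugates (φ-constant C -[1+ 0 ]) (φ-constant (rotate C) -[1+ 0 ])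
            (φ-constant (rotate (rotate C)) -[1+ 0 ])) c′
        γ = α ∔ constant -[1+ 0 ] · β
        difference : Conjugates γ (x + ι -[1+ 0 ] * x′) (y + ι -[1+ 0 ] * y′) (z + ι -[1+ 0 ] * z′)
        difference = conjugates
          (trans (φ-∔ C α _) (+-cong (φ₁ c) (φ₁ negation)))
          (trans (φ-∔ (rotate C) α _) (+-cong (φ₂ c) (φ₂ negation)))
          (trans (φ-∔ (rotate (rotate C)) α _) (+-cong (φ₃ c) (φ₃ negation)))
        γ≡0 : γ ≡ constant (+ 0)
        γ≡0 = φ-faithful γ (trans (φ₁ difference)
            (trans (+-congʳ x≈x′) (solve 1 (λ x → x :+ con -[1+ 0 ] :* x := κ 0) refl x′)))
        vanishing : Conjugates γ (k 0) (k 0) (k 0)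
        vanishing = ≡.subst (λ γ → Conjugates γ (k 0) (k 0) (k 0)) (≡.sym γ≡0)
          (conjugates (φ-constant C (+ 0)) (φ-constant (rotate C) (+ 0))
              (φ-constant (rotate (rotate C)) (+ 0)))
        equal : ∀ {t y y′} → t ≈ y + ι -[1+ 0 ] * y′ → t ≈ k 0 → y ≈ y′
        equal {t} {y} {y′} t≈ t≈0 = x-y≈0⇒x≈y
            (trans (solve 2 (λ y y′ → y :- y′ := y :+ con -[1+ 0 ] :* y′) refl y y′)
            (trans (sym t≈) t≈0))

      conj-eval : ∀ ε → Conjugates (reduce ε) (eval ε r) (eval ε r′) (eval ε r″)
      conj-eval ε = conjugates (sym (eval≈φ C ε)) (sym (eval≈φ (rotate C) ε))
          (sym (eval≈φ (rotate (rotate C)) ε))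

      positive-unit : ∀ {α β x y z x′ y′ z′} → Conjugates α x y z → Conjugates β x′ y′ z′ →
        x * x′ ≈ k 1 → 0< x → 0< y → 0< z → Unit α x y z
      positive-unit {α} {β} {x} {y} {z} {x′} {y′} {z′} c c′ xx′≈1 0<x 0<y 0<z =
        unit c (i*j≡1⇒i≡1 (norm α) (norm β) (ι-cancel-<
            (<-resp refl (sym (norm≈ c)) (pos-* 0<x (pos-* 0<y 0<z)))) (ι-injective norms))
        where
        yz = φ-determines (conj-· c c′) (conjugates (φ-constant C (+ 1))
            (φ-constant (rotate C) (+ 1)) (φ-constant (rotate (rotate C)) (+ 1))) xx′≈1
        norms : ι (norm α ℤ.* norm β) ≈ k 1
        norms = trans (ι-* (norm α) (norm β)) (trans (*-cong (norm≈ c) (norm≈ c′))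
          (trans (solve 6 (λ x y z x′ y′ z′ → x :* (y :* z) :* (x′ :* (y′ :* z′)) :=
              x :* x′ :* (y :* y′ :* (z :* z′))) refl x y z x′ y′ z′)
            (trans (*-cong xx′≈1 (*-cong (proj₁ yz) (proj₂ yz)))
                (solve 0 (κ 1 :* (κ 1 :* κ 1) := κ 1) refl))))
        i*j≡1⇒i≡1 : ∀ i j → + 0 ℤ.< i → i ℤ.* j ≡ + 1 → i ≡ + 1
        i*j≡1⇒i≡1 (+ n) j _ eq = ≡.cong +_ (ℕ.m*n≡1⇒m≡1 n (ℤ.∣ j ∣)
            (≡.trans (≡.sym (ℤ.abs-* (+ n) j)) (≡.cong ℤ.∣_∣ eq)))

    γ-list : List ℤ
    γ-list = (a ℤ.* a ℤ.+ a ℤ.+ + 8) ∷ (a ℤ.* a ℤ.- a ℤ.+ + 1) ∷ (+ 2 ℤ.- a) ∷ []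

    eval-γ : ∀ {r r′ r″} → Cyclic r r′ r″ → eval γ-list r ≈ A + k 12 + (A + k 1) * r + (A - k 2) *
        r′
    eval-γ {r} {r′} C = trans
      (+-cong (trans (ι-+ (a ℤ.* a ℤ.+ a) (+ 8))
          (+-congʳ (trans (ι-+ (a ℤ.* a) a) (+-congʳ (ι-* a a)))))
        (*-congˡ (+-cong (trans (ι-+ (a ℤ.* a ℤ.- a) (+ 1))
            (+-congʳ (trans (ι-+ (a ℤ.* a) (ℤ.- a)) (+-cong (ι-* a a) (ι-neg a)))))
          (*-congˡ (+-congʳ (trans (ι-+ (+ 2) (ℤ.- a)) (+-congˡ (ι-neg a))))))))
      (≈-by (k 2 - A) (x≈y⇒x-y≈0 (r² C)) (solve 3 (λ A r r′ →
        A :* A :+ A :+ κ 8 :+ r :* (A :* A :- A :+ κ 1 :+ r :* (κ 2 :- A :+ r :* κ 0)) :=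
        A :+ κ 12 :+ (A :+ κ 1) :* r :+ (A :- κ 2) :* r′ :+ (κ 2 :- A) :*
            (r :* r :- (A :+ κ 2 :+ A :* r :- r′))) refl A r r′))

    module _ {r r′ r″ : Carrier} (C : Cyclic r r′ r″) (A+1<r : A + k 1 < r) (r″<0 : r″ < k 0) where
      open Units C A+1<r r″<0

      dominated-units : ∀ ε δ → eval ε r * eval δ r ≈ k 1 →
        0< eval ε r × 0< eval ε r′ × 0< eval ε r″ →
        (eval ε r < eval γ-list r × eval ε r′ < eval γ-list r′ × eval ε r″ < eval γ-list r″) ⊎ eval
            γ-list r ≈ eval ε r →
        eval ε r ≈ k 1 ⊎ eval ε r ≈ r * r
      dominated-units ε δ εδ≈1 (0<e₁ , 0<e₂ , 0<e₃) γ≽ε =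
        small-unit (positive-unit (conj-eval ε) (conj-eval δ) εδ≈1 0<e₁ 0<e₂ 0<e₃) 0<e₁ 0<e₂ 0<e₃
            e₁< e₂< e₃<
        where
        bounds : ∀ {x y z} → eval γ-list r < x → eval γ-list r′ < y → eval γ-list r″ < z →
            eval ε r < x × eval ε r′ < y × eval ε r″ < z
        bounds <x <y <z = [ (λ (h₁ , h₂ , h₃) → <-trans h₁ <x , <-trans h₂ <y , <-trans h₃ <z)
          , (λ eq → let h₂ , h₃ = φ-determines (conj-eval γ-list) (conj-eval ε) eq in
              <-resp eq refl <x , <-resp h₂ refl <y , <-resp h₃ refl <z) ]′ γ≽ε
        all = bounds
          (<-resp (sym (trans (eval-γ C) (solve 3
              (λ A r r′ → A :+ κ 12 :+ (A :+ κ 1) :* r :+ (A :- κ 2) :* r′ :=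
            A :+ κ 12 :+ (A :+ κ 1) :* r :- (A :- κ 2) :* :- r′) refl A r r′))) refl γ₁<)
          (<-resp (sym (trans (eval-γ (rotate C))
              (solve 3 (λ A r r′ → A :+ κ 12 :+ (A :+ κ 1) :* r :+ (A :- κ 2) :* r′ :=
            A :+ κ 12 :- (A :+ κ 1) :* :- r :- (A :- κ 2) :* :- r′) refl A r′ r″))) refl γ₂<)
          (<-resp (sym (trans (eval-γ (rotate (rotate C)))
              (solve 3 (λ A r r′ → A :+ κ 12 :+ (A :+ κ 1) :* r :+ (A :- κ 2) :* r′ :=
            A :+ κ 12 :- (A :+ κ 1) :* :- r :+ (A :- κ 2) :* r′) refl A r″ r))) refl γ₃<)
        e₁< = proj₁ all
        e₂< = proj₁ (proj₂ all)
        e₃< = proj₂ (proj₂ all)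

    module FromRoots {r r′ r″ : Carrier}
      (fr : eval (Defs.cubic a) r ≈ k 0) (fr′ : eval (Defs.cubic a) r′ ≈ k 0)
          (fr″ : eval (Defs.cubic a) r″ ≈ k 0)
      (a+1<r : ι (a ℤ.+ + 1) < r) (r′<-1 : r′ < ι -[1+ 0 ]) (-1<r″ : ι -[1+ 0 ] < r″)
          (r″<0 : r″ < k 0) where

      private
        0<a+1 : + 0 ℤ.< a ℤ.+ + 1
        0<a+1 = ℤ.<-≤-trans (ℤ.+<+ (s≤s z≤n)) (ℤ.+-monoˡ-≤ (+ 1) 7≤a)

      open Vieta fr fr′ fr″ (<-trans (ι-mono-< 0<a+1) a+1<r) r′<-1 -1<r″ r″<0 using (cyclic)

      theorem : ∀ ε δ → eval ε r * eval δ r ≈ k 1 →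
        0< eval ε r × 0< eval ε r′ × 0< eval ε r″ →
        (eval ε r < eval γ-list r × eval ε r′ < eval γ-list r′ × eval ε r″ < eval γ-list r″) ⊎
          eval γ-list r ≈ eval ε r →
        eval ε r ≈ eval (+ 1 ∷ []) r ⊎ eval ε r ≈ eval (+ 0 ∷ + 0 ∷ + 1 ∷ []) r
      theorem ε δ εδ≈1 pos γ≽ε = [ (λ eq → inj₁
          (trans eq (solve 1 (λ r → κ 1 := κ 1 :+ r :* κ 0) refl r)))
        , (λ eq → inj₂ (trans eq
            (solve 1 (λ r → r :* r := κ 0 :+ r :* (κ 0 :+ r :* (κ 1 :+ r :* κ 0))) refl r))) ]′
        (dominated-units cyclic (<-resp (ι-+ a (+ 1)) refl a+1<r) r″<0 ε δ εδ≈1 pos γ≽ε)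

-- The real numbers as an ordered ring

open import Defs

module RealNumbers where

  open import Data.Rational.Base as ℚ using (ℚ; 0ℚ; ½; ∣_∣; positive; nonNegative; 1/_; *<*)
  open import Data.Rational.Literals using (fromℤ)
  open Data.Rational.Solver using (module +-*-Solver)
  open Data.Integer.Solver using () renaming (module +-*-Solver to ℤ-Solver)
  open import Data.Nat.Base using (_⊔_)
  open ≡ using (refl; sym; trans; cong; cong₂; subst)
  open +-*-Solver

  module _ {p q : ℚ} where
    p<q⇒0<q-p : p ℚ.< q → 0ℚ ℚ.< q ℚ.- p
    p<q⇒0<q-p p<q = subst (ℚ._< q ℚ.- p) (ℚ.+-inverseʳ p) (ℚ.+-monoˡ-< (ℚ.- p) p<q)

    0<q-p⇒p<q : 0ℚ ℚ.< q ℚ.- p → p ℚ.< q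
    0<q-p⇒p<q 0< = ≡.subst₂ ℚ._<_ (ℚ.+-identityˡ p)
      (solve 2 (λ p q → q :- p :+ p := q) refl p q) (ℚ.+-monoˡ-< p 0<)

    0<p*q : 0ℚ ℚ.< p → 0ℚ ℚ.< q → 0ℚ ℚ.< p ℚ.* q
    0<p*q 0<p 0<q = ℚ.positive⁻¹ (p ℚ.* q) {{ℚ.pos*pos⇒pos p {{positive 0<p}} q {{positive 0<q}}}}

  0<½* : ∀ {p} → 0ℚ ℚ.< p → 0ℚ ℚ.< ½ ℚ.* p
  0<½* = 0<p*q (ℚ.positive⁻¹ ½)

  ∣p∣<q⇒p<q : ∀ {p q} → ∣ p ∣ ℚ.< q → p ℚ.< q
  ∣p∣<q⇒p<q {p} {q} ∣p∣<q = [ (λ eq → subst (ℚ._< q) eq ∣p∣<q) ,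
      (λ eq → ℚ.≤-<-trans (p≤ eq) ∣p∣<q) ]′ (ℚ.∣p∣≡p∨∣p∣≡-p p)
    where
    p≤ : ∣ p ∣ ≡ ℚ.- p → p ℚ.≤ ∣ p ∣
    p≤ eq = ℚ.≤-trans (subst (ℚ._≤ 0ℚ) (solve 1 (λ p → :- (:- p) := p) refl p)
      (ℚ.neg-antimono-≤ (subst (0ℚ ℚ.≤_) eq (ℚ.0≤∣p∣ p)))) (ℚ.0≤∣p∣ p)

  ∣p∣<q⇒-p<q : ∀ {p q} → ∣ p ∣ ℚ.< q → ℚ.- p ℚ.< q
  ∣p∣<q⇒-p<q {p} {q} ∣p∣<q = ∣p∣<q⇒p<q (subst (ℚ._< q) (sym (ℚ.∣-p∣≡∣p∣ p)) ∣p∣<q)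

  ∣p∣<q⇐ : ∀ {p q} → p ℚ.< q → ℚ.- p ℚ.< q → ∣ p ∣ ℚ.< q
  ∣p∣<q⇐ {p} {q} p<q -p<q = [ (λ eq → subst (ℚ._< q) (sym eq) p<q) ,
      (λ eq → subst (ℚ._< q) (sym eq) -p<q) ]′ (ℚ.∣p∣≡p∨∣p∣≡-p p)

  Eventually : (ℕ → Set) → Set
  Eventually P = ∃[ N ] (∀ n → N ℕ.≤ n → P n)

  eventually₂ : ∀ {P Q R : ℕ → Set} → (∀ n → P n → Q n → R n) → Eventually P → Eventually Q →
      Eventually R
  eventually₂ f (M , p) (N , q) = M ⊔ N , λ n n≥ →
    f n (p n (ℕ.m⊔n≤o⇒m≤o M N n≥)) (q n (ℕ.m⊔n≤o⇒n≤o M N n≥))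

  Null : (ℕ → ℚ) → Set
  Null s = ∀ ε → 0ℚ ℚ.< ε → Eventually (λ n → ∣ s n ∣ ℚ.< ε)

  null-cong : ∀ {s t} → (∀ n → s n ≡ t n) → Null s → Null t
  null-cong s≡t s→0 ε 0<ε with s→0 ε 0<ε
  ... | N , h = N , λ n n≥ → subst (λ r → ∣ r ∣ ℚ.< ε) (s≡t n) (h n n≥)

  null-0 : Null (λ _ → 0ℚ)
  null-0 ε 0<ε = 0 , λ _ _ → 0<ε

  null-neg : ∀ {s} → Null s → Null (λ n → ℚ.- s n)
  null-neg {s} s→0 ε 0<ε with s→0 ε 0<ε
  ... | N , h = N , λ n n≥ → subst (ℚ._< ε) (sym (ℚ.∣-p∣≡∣p∣ (s n))) (h n n≥)

  null-+ : ∀ {s t} → Null s → Null t → Null (λ n → s n ℚ.+ t n)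
  null-+ {s} {t} s→0 t→0 ε 0<ε = eventually₂
    (λ n hs ht → ℚ.≤-<-trans (ℚ.∣p+q∣≤∣p∣+∣q∣ (s n) (t n))
      (subst (∣ s n ∣ ℚ.+ ∣ t n ∣ ℚ.<_) (solve 1 (λ ε → con ½ :* ε :+ con ½ :* ε := ε) refl ε)
          (ℚ.+-mono-< hs ht)))
    (s→0 (½ ℚ.* ε) (0<½* 0<ε)) (t→0 (½ ℚ.* ε) (0<½* 0<ε))

  module _ (B : ℚ) (B>0 : ℚ.Positive B) (δ : ℚ) where
    private instance
      _ = B>0
      _ = ℚ.pos⇒nonZero B

    quotient : ℚ
    quotient = 1/ B ℚ.* δ

    0<quotient : 0ℚ ℚ.< δ → 0ℚ ℚ.< quotient
    0<quotient = 0<p*q (ℚ.positive⁻¹ (1/ B) {{ℚ.1/pos⇒pos B}})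

    B*quotient : B ℚ.* quotient ≡ δ
    B*quotient = trans (sym (ℚ.*-assoc B (1/ B) δ))
        (trans (cong (ℚ._* δ) (ℚ.*-inverseʳ B)) (ℚ.*-identityˡ δ))

  null-* : ∀ (x : ℝ) {s} → Null s → Null (λ n → seq x n ℚ.* s n)
  null-* x {s} s→0 ε 0<ε with cauchy⇒bounded {seq x} (cauchy x)
  ... | B , B>0 , bounded = eventually₂ bound bounded
      (s→0 (quotient B B>0 ε) (0<quotient B B>0 ε 0<ε))
    where
    bound : ∀ n → ∣ seq x n ∣ ℚ.≤ B → ∣ s n ∣ ℚ.< quotient B B>0 ε → ∣ seq x n ℚ.* s n ∣ ℚ.< ε
    bound n x≤B s< = ℚ.≤-<-trans
      (subst (ℚ._≤ B ℚ.* ∣ s n ∣) (sym (ℚ.∣p*q∣≡∣p∣*∣q∣ (seq x n) (s n)))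
        (ℚ.*-monoʳ-≤-nonNeg ∣ s n ∣ {{nonNegative (ℚ.0≤∣p∣ (s n))}} x≤B))
      (subst (B ℚ.* ∣ s n ∣ ℚ.<_) (B*quotient B B>0 ε) (ℚ.*-monoʳ-<-pos B {{B>0}} s<))

  pointwise⇒≈ : ∀ (x y : ℝ) → (∀ n → seq x n ≡ seq y n) → x ≈ y
  pointwise⇒≈ x y eq = null-cong
      (λ n → sym (trans (cong (ℚ._- seq y n) (eq n)) (ℚ.+-inverseʳ (seq y n)))) null-0

  -ℝ_ : ℝ → ℝ
  -ℝ x = ι -[1+ 0 ] * x

  +-cong : ∀ {x x′ y y′ : ℝ} → x ≈ x′ → y ≈ y′ → x + y ≈ x′ + y′
  +-cong {x} {x′} {y} {y′} x≈ y≈ = null-cong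
    (λ n → solve 4 (λ x x′ y y′ → (x :- x′) :+ (y :- y′) := (x :+ y) :- (x′ :+ y′)) refl (seq x n)
        (seq x′ n) (seq y n) (seq y′ n))
    (null-+ x≈ y≈)

  *-cong : ∀ {x x′ y y′ : ℝ} → x ≈ x′ → y ≈ y′ → x * y ≈ x′ * y′
  *-cong {x} {x′} {y} {y′} x≈ y≈ = null-cong
    (λ n → solve 4 (λ x x′ y y′ → x :* (y :- y′) :+ y′ :* (x :- x′) := (x :* y) :- (x′ :* y′)) refl
        (seq x n) (seq x′ n) (seq y n) (seq y′ n))
    (null-+ (null-* x y≈) (null-* y′ x≈))

  ≈-sym : ∀ {x y : ℝ} → x ≈ y → y ≈ x
  ≈-sym {x} {y} x≈y = null-cong (λ n → solve 2 (λ x y → :- (x :- y) := y :- x) refl (seq x n)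
      (seq y n)) (null-neg x≈y)

  ≈-trans : ∀ {x y z : ℝ} → x ≈ y → y ≈ z → x ≈ z
  ≈-trans {x} {y} {z} x≈y y≈z = null-cong
    (λ n → solve 3 (λ x y z → (x :- y) :+ (y :- z) := x :- z) refl (seq x n) (seq y n) (seq z n))
        (null-+ x≈y y≈z)

  ℝ-commutativeRing : CommutativeRing 0ℓ 0ℓ
  ℝ-commutativeRing = record
    { Carrier = ℝ ; _≈_ = _≈_ ; _+_ = _+_ ; _*_ = _*_ ; -_ = -ℝ_ ; 0# = ι (+ 0) ; 1# = ι (+ 1)
    ; isCommutativeRing = record
      { isRing = record
        { +-isAbelianGroup = record
          { isGroup = record
            { isMonoid = record
              { isSemigroup = record
                { isMagma = record
                  { isEquivalence = record
                    { refl = λ {x} → pointwise⇒≈ x x (λ _ → refl)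
                    ; sym = λ {x} {y} → ≈-sym {x} {y}
                    ; trans = λ {x} {y} {z} → ≈-trans {x} {y} {z} }
                  ; ∙-cong = λ {x} {x′} {y} {y′} → +-cong {x} {x′} {y} {y′} }
                ; assoc = λ x y z → pointwise⇒≈ (x + y + z) (x + (y + z))
                    (λ n → ℚ.+-assoc (seq x n) (seq y n) (seq z n)) }
              ; identity = (λ x → pointwise⇒≈ (ι (+ 0) + x) x (λ n → ℚ.+-identityˡ (seq x n)))
                         , (λ x → pointwise⇒≈ (x + ι (+ 0)) x (λ n → ℚ.+-identityʳ (seq x n))) }
            ; inverse = (λ x → pointwise⇒≈ (-ℝ x + x) (ι (+ 0))
                (λ n → solve 1 (λ x → con (fromℤ -[1+ 0 ]) :* x :+ x := con 0ℚ) refl (seq x n)))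
                      , (λ x → pointwise⇒≈ (x + -ℝ x) (ι (+ 0))
                          (λ n → solve 1 (λ x → x :+ con (fromℤ -[1+ 0 ]) :* x := con 0ℚ) refl
                          (seq x n)))
            ; ⁻¹-cong = λ {x} {y} → *-cong {ι -[1+ 0 ]} {ι -[1+ 0 ]} {x} {y}
                (pointwise⇒≈ (ι -[1+ 0 ]) (ι -[1+ 0 ]) (λ _ → refl)) }
          ; comm = λ x y → pointwise⇒≈ (x + y) (y + x) (λ n → ℚ.+-comm (seq x n) (seq y n)) }
        ; *-cong = λ {x} {x′} {y} {y′} → *-cong {x} {x′} {y} {y′}
        ; *-assoc = λ x y z → pointwise⇒≈ (x * y * z) (x * (y * z))
            (λ n → ℚ.*-assoc (seq x n) (seq y n) (seq z n))
        ; *-identity = (λ x → pointwise⇒≈ (ι (+ 1) * x) x (λ n → ℚ.*-identityˡ (seq x n)))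
                     , (λ x → pointwise⇒≈ (x * ι (+ 1)) x (λ n → ℚ.*-identityʳ (seq x n)))
        ; distrib = (λ x y z → pointwise⇒≈ (x * (y + z)) (x * y + x * z)
            (λ n → ℚ.*-distribˡ-+ (seq x n) (seq y n) (seq z n)))
                  , (λ x y z → pointwise⇒≈ ((y + z) * x) (y * x + z * x)
                      (λ n → ℚ.*-distribʳ-+ (seq x n) (seq y n) (seq z n))) }
      ; *-comm = λ x y → pointwise⇒≈ (x * y) (y * x) (λ n → ℚ.*-comm (seq x n) (seq y n)) } }

  fromℤ-+ : ∀ i j → fromℤ (i ℤ.+ j) ≡ fromℤ i ℚ.+ fromℤ j
  fromℤ-+ i j = ℚ.toℚᵘ-injective (ℚᵘ.≃-trans
    (ℚᵘ.*≡* (S.solve 2 (λ i j → (i S.:+ j) S.:* S.con (+ 1) S.:=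
        (i S.:* S.con (+ 1) S.:+ j S.:* S.con (+ 1)) S.:* S.con (+ 1)) refl i j))
    (ℚᵘ.≃-sym (ℚ.toℚᵘ-homo-+ (fromℤ i) (fromℤ j))))
    where module S = ℤ-Solver

  fromℤ-* : ∀ i j → fromℤ (i ℤ.* j) ≡ fromℤ i ℚ.* fromℤ j
  fromℤ-* i j = ℚ.toℚᵘ-injective (ℚᵘ.≃-trans (ℚᵘ.*≡* refl)
    (ℚᵘ.≃-sym (ℚ.toℚᵘ-homo-* (fromℤ i) (fromℤ j))))

  <-resp : ∀ {x x′ y y′ : ℝ} → x ≈ x′ → y ≈ y′ → x < y → x′ < y′
  <-resp {x} {x′} {y} {y′} x≈ y≈ (δ , 0<δ , x<y) = η , 0<η ,
    eventually₂ (λ n (hx , hy) → bound (seq x n) (seq x′ n) (seq y n) (seq y′ n) hx hy)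
      (eventually₂ (λ n hx hy → hx , hy) (x≈ η 0<η) (y≈ η 0<η)) x<y
    where
    η = ½ ℚ.* (½ ℚ.* δ)
    0<η = 0<½* (0<½* 0<δ)
    bound : ∀ x x′ y y′ → ∣ x ℚ.- x′ ∣ ℚ.< η → ∣ y ℚ.- y′ ∣ ℚ.< η → x ℚ.+ δ ℚ.< y → x′ ℚ.+ η ℚ.< y′
    bound x x′ y y′ hx hy x<y = 0<q-p⇒p<q (subst (0ℚ ℚ.<_)
      (solve 5 (λ x x′ y y′ δ → let η = con ½ :* (con ½ :* δ) in
         (y :- (x :+ δ)) :+ (η :- :- (x :- x′)) :+ (η :- (y :- y′)) :+ η := y′ :- (x′ :+ η)) refl x
             x′ y y′ δ)
      (ℚ.+-mono-< (ℚ.+-mono-< (ℚ.+-mono-< (p<q⇒0<q-p x<y) (p<q⇒0<q-p (∣p∣<q⇒-p<q hx)))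
          (p<q⇒0<q-p (∣p∣<q⇒p<q hy))) 0<η))

  <-trans : ∀ {x y z : ℝ} → x < y → y < z → x < z
  <-trans {x} {y} {z} (δ , 0<δ , x<y) (δ′ , 0<δ′ , y<z) = δ , 0<δ ,
    eventually₂ (λ n h h′ → ℚ.<-trans h (ℚ.<-trans (0<q-p⇒p<q (subst (0ℚ ℚ.<_)
      (solve 2 (λ y δ → δ := (y :+ δ) :- y) refl (seq y n) δ′) 0<δ′)) h′)) x<y y<z

  <-irrefl : ∀ {x : ℝ} → ¬ x < x
  <-irrefl {x} (δ , 0<δ , N , h) = ℚ.<-asym (h N ℕ.≤-refl)
    (0<q-p⇒p<q (subst (0ℚ ℚ.<_) (solve 2 (λ x δ → δ := (x :+ δ) :- x) refl (seq x N) δ) 0<δ))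

  <-cotrans : ∀ {x y : ℝ} → x < y → ∀ z → x < z ⊎ z < y
  <-cotrans {x} {y} (δ , 0<δ , K , x<y) z = decide (seq x M ℚ.+ ½ ℚ.* δ ℚ.<? seq z M)
    where
    η = ½ ℚ.* (½ ℚ.* (½ ℚ.* δ))
    0<η = 0<½* (0<½* (0<½* 0<δ))
    cx = cauchy x η 0<η
    cy = cauchy y η 0<η
    cz = cauchy z η 0<η
    M = (proj₁ cx ⊔ proj₁ cy) ⊔ (proj₁ cz ⊔ K)
    Mx≤ : proj₁ cx ℕ.≤ M
    Mx≤ = ℕ.≤-trans (ℕ.m≤m⊔n (proj₁ cx) (proj₁ cy)) (ℕ.m≤m⊔n _ (proj₁ cz ⊔ K))
    My≤ : proj₁ cy ℕ.≤ M
    My≤ = ℕ.≤-trans (ℕ.m≤n⊔m (proj₁ cx) (proj₁ cy)) (ℕ.m≤m⊔n _ (proj₁ cz ⊔ K))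
    Mz≤ : proj₁ cz ℕ.≤ M
    Mz≤ = ℕ.≤-trans (ℕ.m≤m⊔n (proj₁ cz) K) (ℕ.m≤n⊔m (proj₁ cx ⊔ proj₁ cy) _)
    K≤ : K ℕ.≤ M
    K≤ = ℕ.≤-trans (ℕ.m≤n⊔m (proj₁ cz) K) (ℕ.m≤n⊔m (proj₁ cx ⊔ proj₁ cy) _)
    below : ∀ xM zM xn zn → xM ℚ.+ ½ ℚ.* δ ℚ.< zM → ∣ xM ℚ.- xn ∣ ℚ.< η → ∣ zM ℚ.- zn ∣ ℚ.< η →
        xn ℚ.+ η ℚ.< zn
    below xM zM xn zn h hx hz = 0<q-p⇒p<q (subst (0ℚ ℚ.<_)
      (solve 5 (λ xM zM xn zn δ → let η = con ½ :* (con ½ :* (con ½ :* δ)) in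
        (zM :- (xM :+ con ½ :* δ)) :+ (η :- :- (xM :- xn)) :+ (η :- (zM :- zn)) :+ η :=
            zn :- (xn :+ η)) refl xM zM xn zn δ)
      (ℚ.+-mono-< (ℚ.+-mono-< (ℚ.+-mono-< (p<q⇒0<q-p h) (p<q⇒0<q-p (∣p∣<q⇒-p<q hx)))
          (p<q⇒0<q-p (∣p∣<q⇒p<q hz))) 0<η))
    above : ∀ {xM yM zM} → ¬ xM ℚ.+ ½ ℚ.* δ ℚ.< zM → xM ℚ.+ δ ℚ.< yM → zM ℚ.+ ½ ℚ.* δ ℚ.< yM
    above {xM} ≮ h = ℚ.≤-<-trans (subst (_ ℚ.≤_)
      (solve 2 (λ x δ → x :+ con ½ :* δ :+ con ½ :* δ := x :+ δ) refl xM δ)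
          (ℚ.+-monoˡ-≤ (½ ℚ.* δ) (ℚ.≮⇒≥ ≮))) h
    decide : _ → x < z ⊎ z < y
    decide (yes p) = inj₁ (η , 0<η , M , λ n n≥ → below (seq x M) (seq z M) (seq x n) (seq z n) p
      (proj₂ cx M n Mx≤ (ℕ.≤-trans Mx≤ n≥)) (proj₂ cz M n Mz≤ (ℕ.≤-trans Mz≤ n≥)))
    decide (no ≮) = inj₂ (η , 0<η , M , λ n n≥ →
        below (seq z M) (seq y M) (seq z n) (seq y n)
        (above {seq x M} {seq y M} {seq z M} ≮ (x<y M K≤))
      (proj₂ cz M n Mz≤ (ℕ.≤-trans Mz≤ n≥)) (proj₂ cy M n My≤ (ℕ.≤-trans My≤ n≥)))

  <-tight : ∀ {x y : ℝ} → ¬ x < y → ¬ y < x → x ≈ y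
  <-tight {x} {y} x≮y y≮x ε 0<ε = M , close
    where
    η = ½ ℚ.* (½ ℚ.* ε)
    0<η = 0<½* (0<½* 0<ε)
    cx = cauchy x η 0<η
    cy = cauchy y η 0<η
    M = proj₁ cx ⊔ proj₁ cy
    Mx≤ : ∀ {n} → M ℕ.≤ n → proj₁ cx ℕ.≤ n
    Mx≤ = ℕ.m⊔n≤o⇒m≤o _ _
    My≤ : ∀ {n} → M ℕ.≤ n → proj₁ cy ℕ.≤ n
    My≤ = ℕ.m⊔n≤o⇒n≤o (proj₁ cx) _
    -- A difference above ¾ε at one late index would persist as a uniform gap.
    apart : ∀ (x y : ℝ) → ¬ x < y → (∀ n → M ℕ.≤ n → ∀ k → M ℕ.≤ k → ∣ seq x n ℚ.- seq x k ∣ ℚ.< η)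
        →
      (∀ n → M ℕ.≤ n → ∀ k → M ℕ.≤ k → ∣ seq y n ℚ.- seq y k ∣ ℚ.< η) →
      ∀ n → M ℕ.≤ n → seq y n ℚ.- seq x n ℚ.≤ ½ ℚ.* ε ℚ.+ η
    apart x y x≮y hx hy n n≥ = ℚ.≮⇒≥ λ lt → x≮y
        (η , 0<η , M , λ k k≥ → gap {seq x n} {seq x k} {seq y n} {seq y k} lt (hx n n≥ k k≥)
        (hy n n≥ k k≥))
      where
      gap : ∀ {xn xk yn yk} → ½ ℚ.* ε ℚ.+ η ℚ.< yn ℚ.- xn → ∣ xn ℚ.- xk ∣ ℚ.< η →
          ∣ yn ℚ.- yk ∣ ℚ.< η → xk ℚ.+ η ℚ.< yk
      gap {xn} {xk} {yn} {yk} h hx hy = 0<q-p⇒p<q (subst (0ℚ ℚ.<_)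
        (solve 5 (λ xn xk yn yk ε → let η = con ½ :* (con ½ :* ε) in
          ((yn :- xn) :- (con ½ :* ε :+ η)) :+ (η :- :- (xn :- xk)) :+ (η :- (yn :- yk)) :=
              yk :- (xk :+ η)) refl xn xk yn yk ε)
        (ℚ.+-mono-< (ℚ.+-mono-< (p<q⇒0<q-p h) (p<q⇒0<q-p (∣p∣<q⇒-p<q hx)))
            (p<q⇒0<q-p (∣p∣<q⇒p<q hy))))
    3/4ε<ε : ½ ℚ.* ε ℚ.+ η ℚ.< ε
    3/4ε<ε = 0<q-p⇒p<q (subst (0ℚ ℚ.<_) (solve 1
        (λ ε → con ½ :* (con ½ :* ε) := ε :- (con ½ :* ε :+ con ½ :* (con ½ :* ε))) refl ε) 0<η)
    hx : ∀ n → M ℕ.≤ n → ∀ k → M ℕ.≤ k → ∣ seq x n ℚ.- seq x k ∣ ℚ.< η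
    hx n n≥ k k≥ = proj₂ cx n k (Mx≤ n≥) (Mx≤ k≥)
    hy : ∀ n → M ℕ.≤ n → ∀ k → M ℕ.≤ k → ∣ seq y n ℚ.- seq y k ∣ ℚ.< η
    hy n n≥ k k≥ = proj₂ cy n k (My≤ n≥) (My≤ k≥)
    close : ∀ n → M ℕ.≤ n → ∣ seq x n ℚ.- seq y n ∣ ℚ.< ε
    close n n≥ = ∣p∣<q⇐ (ℚ.≤-<-trans (apart y x y≮x hy hx n n≥) 3/4ε<ε)
      (subst (ℚ._< ε) (solve 2 (λ x y → y :- x := :- (x :- y)) refl (seq x n) (seq y n))
          (ℚ.≤-<-trans (apart x y x≮y hx hy n n≥) 3/4ε<ε))

  +-monoʳ-< : ∀ (z : ℝ) {x y : ℝ} → x < y → z + x < z + y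
  +-monoʳ-< z {x} {y} (δ , 0<δ , N , h) = δ , 0<δ , N , λ n n≥ →
    subst (ℚ._< seq z n ℚ.+ seq y n) (sym (ℚ.+-assoc (seq z n) (seq x n) δ))
        (ℚ.+-monoʳ-< (seq z n) (h n n≥))

  *-pos : ∀ {x y : ℝ} → ι (+ 0) < x → ι (+ 0) < y → ι (+ 0) < x * y
  *-pos {x} {y} (δ , 0<δ , 0<x) (δ′ , 0<δ′ , 0<y) = δ ℚ.* δ′ , 0<p*q 0<δ 0<δ′ ,
      eventually₂ bound 0<x 0<y
    where
    bound : ∀ n → 0ℚ ℚ.+ δ ℚ.< seq x n → 0ℚ ℚ.+ δ′ ℚ.< seq y n →
        0ℚ ℚ.+ δ ℚ.* δ′ ℚ.< seq x n ℚ.* seq y n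
    bound n hx hy = 0<q-p⇒p<q (subst (0ℚ ℚ.<_)
      (solve 4 (λ x y δ δ′ → (x :- (con 0ℚ :+ δ)) :* y :+ δ :* (y :- (con 0ℚ :+ δ′)) :=
          x :* y :- (con 0ℚ :+ δ :* δ′)) refl (seq x n) (seq y n) δ δ′)
      (ℚ.+-mono-< (0<p*q (p<q⇒0<q-p hx) (ℚ.<-trans 0<δ′
          (subst (ℚ._< seq y n) (ℚ.+-identityˡ δ′) hy))) (0<p*q 0<δ (p<q⇒0<q-p hy))))

  *-cancel-pos : ∀ {x y : ℝ} → ι (+ 0) < x → ι (+ 0) < x * y → ι (+ 0) < y
  *-cancel-pos {x} {y} (d , 0<d , 0<x) (δ , 0<δ , 0<xy) with cauchy⇒bounded {seq x} (cauchy x)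
  ... | B , B>0 , bounded = η , 0<η , eventually₂ bound (eventually₂ (λ _ → _,_) bounded 0<x) 0<xy
    where
    η = quotient B B>0 δ
    0<η = 0<quotient B B>0 δ 0<δ
    bound : ∀ n → ∣ seq x n ∣ ℚ.≤ B × (0ℚ ℚ.+ d ℚ.< seq x n) → 0ℚ ℚ.+ δ ℚ.< seq x n ℚ.* seq y n →
        0ℚ ℚ.+ η ℚ.< seq y n
    bound n (∣x∣≤B , d<x) δ<xy = ℚ.≰⇒> λ y≤η → ℚ.<-irrefl refl (ℚ.<-≤-trans δ<xy (ℚ.≤-trans
        (ℚ.*-monoˡ-≤-nonNeg (seq x n) {{nonNegative (ℚ.<⇒≤ 0<xn)}}
            (subst (seq y n ℚ.≤_) (ℚ.+-identityˡ η) y≤η))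
        (subst (seq x n ℚ.* η ℚ.≤_) (trans (B*quotient B B>0 δ) (sym (ℚ.+-identityˡ δ)))
          (ℚ.*-monoʳ-≤-nonNeg η {{nonNegative (ℚ.<⇒≤ 0<η)}}
              (subst (ℚ._≤ B) (ℚ.0≤p⇒∣p∣≡p (ℚ.<⇒≤ 0<xn)) ∣x∣≤B)))))
      where
      0<xn : 0ℚ ℚ.< seq x n
      0<xn = ℚ.<-trans 0<d (subst (ℚ._< seq x n) (ℚ.+-identityˡ d) d<x)

  ι-mono-< : ∀ {i j} → i ℤ.< j → ι i < ι j
  ι-mono-< {i} {j} i<j = ½ ℚ.* (fromℤ j ℚ.- fromℤ i) , 0<½* 0<j-i , 0 , λ _ _ →
      0<q-p⇒p<q (subst (0ℚ ℚ.<_)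
      (solve 2 (λ i j → con ½ :* (j :- i) := j :- (i :+ con ½ :* (j :- i))) refl (fromℤ i)
          (fromℤ j)) (0<½* 0<j-i))
    where
    0<j-i : 0ℚ ℚ.< fromℤ j ℚ.- fromℤ i
    0<j-i = p<q⇒0<q-p {fromℤ i} {fromℤ j} (*<*
        (≡.subst₂ ℤ._<_ (sym (ℤ.*-identityʳ i)) (sym (ℤ.*-identityʳ j)) i<j))

  ℝ-orderedRing : OrderedRing
  ℝ-orderedRing = record
    { commutativeRing = ℝ-commutativeRing
    ; _<_ = _<_
    ; <-resp = λ {x} {x′} {y} {y′} → <-resp {x} {x′} {y} {y′}
    ; <-irrefl = λ {x} → <-irrefl {x}
    ; <-trans = λ {x} {y} {z} → <-trans {x} {y} {z}
    ; <-cotrans = λ {x} {y} → <-cotrans {x} {y}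
    ; <-tight = λ {x} {y} → <-tight {x} {y}
    ; +-monoʳ-< = λ z {x} {y} → +-monoʳ-< z {x} {y}
    ; *-pos = λ {x} {y} → *-pos {x} {y}
    ; *-cancel-pos = λ {x} {y} → *-cancel-pos {x} {y}
    ; ι = ι
    ; ι-+ = λ i j → pointwise⇒≈ (ι (i ℤ.+ j)) (ι i + ι j) (λ _ → fromℤ-+ i j)
    ; ι-* = λ i j → pointwise⇒≈ (ι (i ℤ.* j)) (ι i * ι j) (λ _ → fromℤ-* i j)
    ; ι-neg = λ i → pointwise⇒≈ (ι (ℤ.- i)) (-ℝ ι i)
        (λ _ → trans (cong fromℤ (sym (ℤ.-1*i≡-i i))) (fromℤ-* -[1+ 0 ] i))
    ; ι-0 = pointwise⇒≈ (ι (+ 0)) (ι (+ 0)) (λ _ → refl)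
    ; ι-1 = pointwise⇒≈ (ι (+ 1)) (ι (+ 1)) (λ _ → refl)
    ; ι-mono-< = ι-mono-<
    }

open import Data.Integer.Base using (_≤_)

lemma3p1 : (a : ℤ) → + 7 ≤ a → (R : Roots a) → let open ℤ[ρ] R in
    (ε : ℤ[X]) → IsUnit ε → TotallyPositive ε → γ ≽ ε → ε ≃ one ⊎ ε ≃ ρ²
lemma3p1 a 7≤a R ε (δ , εδ≈1) ε≻0 γ≽ε =
  FromRoots.theorem {ρ} {ρ′} {ρ″} ρ-root ρ′-root ρ″-root a+1<ρ ρ′<-1 -1<ρ″ ρ″<0 ε δ εδ≈1 ε≻0 γ≽ε
  where
  open Roots R
  open OrderedRingTheory.Main RealNumbers.ℝ-orderedRing a 7≤a
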